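{- Let $x$ be a fixed-point-free involution in $S_{2n}$. Then $\mathcal{A}_{\mathrm{FPF}}(x)^{ -1}=\{u\in S_{2n}:\hat0_{\mathrm{FPF}}(x)\preceq_{\mathcal{A}_{\mathrm{FPF}}}u\}=\{u\in S_{2n}:u\preceq_{\mathcal{A}_{\mathrm{FPF}}}\hat1_{\mathrm{FPF}}(x)\}$.
   Context: $S_{2n}$ has simple generators $s_i=(i,i+1)$ and length $\ell$; permutations are identified with one-line sequences. The Demazure product $\circ$ is the unique associative operation on $S_{2n}$ with $s\circ w = sw$ if $\ell(sw)>\ell(w)$ and $s\circ w=w$ otherwise, and $w\circ s=ws$ if $\ell(ws)>\ell(w)$ and $w\circ s = w$ otherwise. Let $w_{\mathrm{fpf}}=s_1s_3\cdots s_{2n-1}$; $\mathcal{A}_{\mathrm{FPF}}(x)$ is the set of minimal-length $w\in S_{2n}$ with $w^{ -1}\circ w_{\mathrm{fpf}}\circ w=x$, and $\mathcal{A}_{\mathrm{FPF}}(x)^{ -1}=\{u^{ -1}:u\in\mathcal{A}_{\mathrm{FPF}}(x)\}$. $\prec_{\mathcal{A}_{\mathrm{FPF}}}$ is the transitive closure of the relation on length-$2n$ integer sequences in which a sequence with $[a,d,b,c]$ in positions $2i-1,2i,2i+1,2i+2$ precedes the sequence with $[b,c,a,d]$ in those positions (all other entries equal), whenever $a\le b\le c\le d$; $\preceq$ means $\prec$ or equal. List the pairs $\{(a,b):a<b=x(a)\}$ as $(a_1,b_1),\dots,(a_n,b_n)$ with $a_1<\dots<a_n$, and as $(c_1,d_1),\dots,(c_n,d_n)$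 with $d_1<\dots<d_n$. Then $\hat0_{\mathrm{FPF}}(x)=[a_1,b_1,\dots,a_n,b_n]$ and $\hat1_{\mathrm{FPF}}(x)=[c_1,d_1,\dots,c_n,d_n]$. -}

module Defs where

open import Data.Nat using (ℕ; zero; suc; _+_; _*_; _≤_; _<_; _≡ᵇ_; _<ᵇ_)
open import Data.Bool using (Bool; true; false; if_then_else_)
open import Data.List using (List; []; _∷_; _++_; map; foldl; foldr; applyUpTo; upTo; length; concatMap)
open import Data.Maybe using (Maybe; just; nothing)
open import Data.Product using (Σ; _×_; ∃-syntax)
open import Data.Sum using (_⊎_)
open import Relation.Binary.PropositionalEquality using (_≡_; _≢_)
open import Relation.Binary.Construct.Closure.Transitive using (TransClosure)
open import Data.List.Relation.Binary.Permutation.Propositional using (_↭_)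

-- Permutations of {1,…,m} are represented by their one-line notation
-- [w(1), …, w(m)] as lists of natural numbers.

range : ℕ → List ℕ
range m = applyUpTo suc m

IsPerm : ℕ → List ℕ → Set
IsPerm m w = w ↭ range m

-- w(i), 1-indexed (junk value 0 out of range)
at : List ℕ → ℕ → ℕ
at [] _ = 0
at (x ∷ xs) zero = 0
at (x ∷ xs) (suc zero) = x
at (x ∷ xs) (suc (suc k)) = at xs (suc k)

comp : List ℕ → List ℕ → List ℕ
comp u v = map (at u) v

indexOf : ℕ → List ℕ → ℕ
indexOf j [] = 0
indexOf j (x ∷ xs) = if x ≡ᵇ j then 1 else suc (indexOf j xs)

invPerm : List ℕ → List ℕ
invPerm w = map (λ j → indexOf j w) (range (length w))

-- Coxeter length ℓ(w) = number of inversions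
countLess : ℕ → List ℕ → ℕ
countLess x [] = 0
countLess x (y ∷ ys) = (if y <ᵇ x then 1 else 0) + countLess x ys

len : List ℕ → ℕ
len [] = 0
len (x ∷ xs) = countLess x xs + len xs

sgen : ℕ → ℕ → List ℕ
sgen m i = map (λ j → if j ≡ᵇ i then suc i else (if j ≡ᵇ suc i then i else j)) (range m)

demR : List ℕ → ℕ → List ℕ
demR w i = if len w <ᵇ len (comp w (sgen (length w) i)) then comp w (sgen (length w) i) else w

firstDescent : List ℕ → Maybe ℕ
firstDescent (a ∷ b ∷ r) = if b <ᵇ a then just 1 else Data.Maybe.map suc (firstDescent (b ∷ r))
firstDescent _ = nothing

-- a reduced word [a₁,…,a_k] of w (w = s_{a₁} ⋯ s_{a_k}), with fuel
redWordF : ℕ → List ℕ → List ℕ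
redWordF zero w = []
redWordF (suc f) w with firstDescent w
... | nothing = []
... | just i = redWordF f (comp w (sgen (length w) i)) ++ (i ∷ [])

redWord : List ℕ → List ℕ
redWord w = redWordF (len w) w

dem : List ℕ → List ℕ → List ℕ
dem u w = foldl demR u (redWord w)

wfpf : ℕ → List ℕ
wfpf n = foldr comp (range (2 * n)) (map (λ k → sgen (2 * n) (suc (2 * k))) (upTo n))

IsFPFInvolution : ℕ → List ℕ → Set
IsFPFInvolution n x = IsPerm (2 * n) x ×
  (∀ i → 1 ≤ i → i ≤ 2 * n → (at x (at x i) ≡ i) × (at x i ≢ i))

InAFPF : ℕ → List ℕ → List ℕ → Set
InAFPF n x w = IsPerm (2 * n) w ×
  (dem (dem (invPerm w) (wfpf n)) w ≡ x) ×
  (∀ v → IsPerm (2 * n) v → dem (dem (invPerm v) (wfpf n)) v ≡ x → len w ≤ len v)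

InAFPFinv : ℕ → List ℕ → List ℕ → Set
InAFPFinv n x u = ∃[ w ] (InAFPF n x w × u ≡ invPerm w)

data Step : List ℕ → List ℕ → Set where
  step : ∀ (pre : List ℕ) k a b c d suf → length pre ≡ 2 * k →
         a ≤ b → b ≤ c → c ≤ d →
         Step (pre ++ a ∷ d ∷ b ∷ c ∷ suf) (pre ++ b ∷ c ∷ a ∷ d ∷ suf)

_≺_ : List ℕ → List ℕ → Set
_≺_ = TransClosure Step

_≼_ : List ℕ → List ℕ → Set
u ≼ v = (u ≺ v) ⊎ (u ≡ v)

zeroHat : ℕ → List ℕ → List ℕ
zeroHat n x = concatMap (λ a → if a <ᵇ at x a then a ∷ at x a ∷ [] else []) (range (2 * n))

oneHat : ℕ → List ℕ → List ℕ
oneHat n x = concatMap (λ d → if at x d <ᵇ d then at x d ∷ d ∷ [] else []) (range (2 * n))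

{-# OPTIONS --safe #-}

-- Each letter i of a reduced word of w acts on the twisted conjugate w⁻¹ ∘ wfpf ∘ w by Demazure
-- conjugation z ↦ sᵢ ∘ z ∘ sᵢ, since left and right Demazure multiplication commute. One such
-- step raises the length by at most 2, so every w producing x satisfies
-- ℓ(x) ≤ ℓ(wfpf) + 2 ℓ(w), and following the equality case along a reduced word shows that it
-- holds exactly when the blocks [u₁,u₂], [u₃,u₄], … of u = w⁻¹ are the arcs (a < b = x(a)) of x,
-- arranged in a linear extension of the coordinatewise order on arcs. Two adjacent blocks of a
-- linear extension may be exchanged exactly when the arcs are nested, and this is the covering
-- relation of ≺; sorting the blocks by left or by right endpoints leads to 0̂ and 1̂.

module Submission where

open import Defs
open import Data.Bool using (true; false; if_then_else_)
open import Data.List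
  using (List; []; _∷_; _++_; map; foldl; foldr; length; filter; applyUpTo; upTo; concatMap)
open import Data.List.Membership.Propositional using (_∈_)
open import Data.List.Membership.Propositional.Properties using (∈-applyUpTo⁺; ∈-applyUpTo⁻)
open import Data.List.Properties
  using (length-map; length-applyUpTo; map-∘; map-cong; map-cong-local; map-id; foldl-++;
         filter-accept; filter-reject; ∷-injective)
open import Data.List.Relation.Binary.Equality.Propositional using (≋⇒≡)
open import Data.List.Relation.Binary.Permutation.Propositional
  using (_↭_; ↭-refl; ↭-reflexive; ↭-sym; ↭-trans; ↭⇒↭ₛ; prep; swap)
open import Data.List.Relation.Binary.Permutation.Propositional.Properties
  using (All-resp-↭; ∈-resp-↭; ↭-length; shift; ++⁺; ++⁺ˡ; filter-↭)
  renaming (map⁺ to ↭-map⁺)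
import Data.List.Relation.Binary.Permutation.Setoid.Properties as PermutationSetoid
open import Data.List.Relation.Unary.All as All using (All; []; _∷_)
import Data.List.Relation.Unary.All.Properties as AllProperties
open import Data.List.Relation.Unary.AllPairs as AllPairs using (AllPairs; []; _∷_)
import Data.List.Relation.Unary.AllPairs.Properties as AllPairsProperties
open import Data.List.Relation.Unary.Any using (here; there)
open import Data.List.Relation.Unary.Linked using (Linked; []; [-]; _∷_)
import Data.List.Relation.Unary.Linked.Properties as Linked
open import Data.List.Relation.Unary.Sorted.TotalOrder.Properties using (↗↭↗⇒≋)
open import Data.List.Relation.Unary.Unique.Propositional using (Unique)
import Data.List.Relation.Unary.Unique.Propositional.Properties as Unique
open import Data.Maybe using (just; nothing)
open import Data.Nat
open import Data.Nat.Properties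
open import Data.Product using (∃-syntax; _×_; _,_; proj₁; proj₂)
open import Data.Sum using (_⊎_; inj₁; inj₂)
open import Function using (_∘_; id)
open import Function.Bundles using (_⇔_; mk⇔; module Equivalence)
open import Level using (0ℓ)
open import Relation.Binary.Construct.Closure.Transitive using ([_]; _∷_)
  renaming (_++_ to _⁺++⁺_)
open import Relation.Binary.Definitions using (tri<; tri≈; tri>)
open import Relation.Binary.PropositionalEquality
  using (_≡_; _≢_; refl; sym; cong; cong₂; subst; subst₂; setoid; module ≡-Reasoning)
  renaming (trans to ≡-trans)
open import Relation.Nullary using (¬_; Dec; yes; no; contradiction)
open import Relation.Nullary.Decidable using (dec-true; dec-false)
open import Relation.Unary using (Pred; Decidable)

-- The Demazure product is computed from the particular word `redWord`, so the inductions run over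
-- `Reduced`, a certificate that a given word is built by length-raising letters. Appending `i` to
-- the word of w replaces w⁻¹ by sᵢ w⁻¹, a change at the far left end of a product that is evaluated
-- by two folds from the right side. `demL` names this left action, and its commutation with a
-- single `demR` lets it pass through both folds. The 2 in the length bound is one inversion for
-- each side of sᵢ ∘ z ∘ sᵢ. In the equality case both multiplications are therefore ascents and the
-- letter acts as ordinary conjugation by sᵢ, which relabels the endpoints of the arcs. The bound by
-- itself does not show that a shortest w attains it: some permutation has to be exhibited that
-- does. The inverse of 0̂ is this witness. Its blocks are ordered by left endpoint, so no later arc
-- is smaller in both coordinates, and the equality case applies to it directly.

InRange : ℕ → ℕ → Set
InRange m j = 1 ≤ j × j ≤ m

lower∈ : ∀ {m i} → 1 ≤ i → i < m → InRange m i
lower∈ 1≤i i<m = 1≤i , <⇒≤ i<m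

upper∈ : ∀ {m i} → 1 ≤ i → i < m → InRange m (suc i)
upper∈ 1≤i i<m = s≤s z≤n , i<m

<ᵇ-true : ∀ {a b} → a < b → (a <ᵇ b) ≡ true
<ᵇ-true {a} {b} = dec-true (a <? b)

<ᵇ-false : ∀ {a b} → ¬ (a < b) → (a <ᵇ b) ≡ false
<ᵇ-false {a} {b} = dec-false (a <? b)

≡ᵇ-true : ∀ {a b} → a ≡ b → (a ≡ᵇ b) ≡ true
≡ᵇ-true {a} {b} = dec-true (a ≟ b)

≡ᵇ-false : ∀ {a b} → a ≢ b → (a ≡ᵇ b) ≡ false
≡ᵇ-false {a} {b} = dec-false (a ≟ b)

-- Adjacent transpositions

tr : ℕ → ℕ → ℕ
tr i j = if j ≡ᵇ i then suc i else (if j ≡ᵇ suc i then i else j)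

-- The last index carries the value `tr i j`, so one match settles the nested conditional and
-- identifies `j` at the same time.
data TrView (i : ℕ) : ℕ → ℕ → Set where
  lower : TrView i i (suc i)
  upper : TrView i (suc i) i
  other : ∀ {j} → j ≢ i → j ≢ suc i → TrView i j j

trView : ∀ i j → TrView i j (tr i j)
trView i j with j ≟ i
... | yes refl rewrite ≡ᵇ-true {j} refl = lower
... | no j≢i rewrite ≡ᵇ-false j≢i with j ≟ suc i
...   | yes refl rewrite ≡ᵇ-true {i} refl = upper
...   | no j≢1+i rewrite ≡ᵇ-false j≢1+i = other j≢i j≢1+i

tr-lower : ∀ i → tr i i ≡ suc i
tr-lower i with tr i i | trView i i
... | _ | lower = refl
... | _ | other i≢i _ = contradiction refl i≢i

tr-upper : ∀ i → tr i (suc i) ≡ i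
tr-upper i with tr i (suc i) | trView i (suc i)
... | _ | upper = refl
... | _ | other _ n = contradiction refl n

tr-other : ∀ {i j} → j ≢ i → j ≢ suc i → tr i j ≡ j
tr-other {i} {j} j≢i j≢1+i with tr i j | trView i j
... | _ | lower = contradiction refl j≢i
... | _ | upper = contradiction refl j≢1+i
... | _ | other _ _ = refl

tr-involutive : ∀ i j → tr i (tr i j) ≡ j
tr-involutive i j with tr i j | trView i j
... | _ | lower = tr-upper i
... | _ | upper = tr-lower i
... | _ | other p q = tr-other p q

tr-injective : ∀ i {j k} → tr i j ≡ tr i k → j ≡ k
tr-injective i {j} {k} eq =
  ≡-trans (sym (tr-involutive i j)) (≡-trans (cong (tr i) eq) (tr-involutive i k))

tr-suc : ∀ i j → tr (suc i) (suc j) ≡ suc (tr i j)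
tr-suc i j with tr i j | trView i j
... | _ | lower = tr-lower (suc i)
... | _ | upper = tr-upper (suc i)
... | _ | other p q = tr-other (p ∘ suc-injective) (q ∘ suc-injective)

tr-inRange : ∀ {m i j} → 1 ≤ i → i < m → InRange m j → InRange m (tr i j)
tr-inRange {m} {i} {j} 1≤i i<m p with tr i j | trView i j
... | _ | lower = s≤s z≤n , i<m
... | _ | upper = 1≤i , <⇒≤ i<m
... | _ | other _ _ = p

-- The two exchanged values are neighbours, so no third value lies between them and only their own
-- order can change. Every exceptional case below originates here.
tr-mono : ∀ i {a b} → a < b → tr i a < tr i b ⊎ (a ≡ i × b ≡ suc i)
tr-mono i {a} {b} a<b with tr i a | trView i a | tr i b | trView i b
... | _ | lower | _ | lower = contradiction a<b (<-irrefl refl)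
... | _ | lower | _ | upper = inj₂ (refl , refl)
... | _ | lower | _ | other _ q = inj₁ (≤∧≢⇒< a<b (q ∘ sym))
... | _ | upper | _ | lower = inj₁ (n<1+n i)
... | _ | upper | _ | upper = contradiction a<b (<-irrefl refl)
... | _ | upper | _ | other _ _ = inj₁ (<-trans (n<1+n i) a<b)
... | _ | other _ _ | _ | lower = inj₁ (<-trans a<b (n<1+n i))
... | _ | other p _ | _ | upper = inj₁ (≤∧≢⇒< (s≤s⁻¹ a<b) p)
... | _ | other _ _ | _ | other _ _ = inj₁ a<b

tr-mono⁻ : ∀ i {a b} → tr i a < tr i b → a < b ⊎ (a ≡ suc i × b ≡ i)
tr-mono⁻ i {a} {b} lt with tr-mono i lt
... | inj₁ p = inj₁ (subst₂ _<_ (tr-involutive i a) (tr-involutive i b) p)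
... | inj₂ (p , q) = inj₂
  ( tr-injective i (≡-trans p (sym (tr-upper i)))
  , tr-injective i (≡-trans q (sym (tr-lower i))) )

-- One-line notation

-- The bound excludes `k = 0`, where the left side is the head `x` and the right side is the junk
-- value.
at-suc : ∀ x xs {k} → 1 ≤ k → at (x ∷ xs) (suc k) ≡ at xs k
at-suc x xs (s≤s _) = refl

at-map : ∀ (f : ℕ → ℕ) w {k} → InRange (length w) k → at (map f w) k ≡ f (at w k)
at-map f (x ∷ w) {suc zero} _ = refl
at-map f (x ∷ w) {suc (suc k)} (_ , s≤s p) = at-map f w (s≤s z≤n , p)

at-applyUpTo : ∀ (f : ℕ → ℕ) {m k} → k < m → at (applyUpTo f m) (suc k) ≡ f k
at-applyUpTo f {suc m} {zero} _ = refl
at-applyUpTo f {suc m} {suc k} (s≤s p) = at-applyUpTo (f ∘ suc) p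

at-range : ∀ {m k} → InRange m k → at (range m) k ≡ k
at-range {k = suc k} (_ , p) = at-applyUpTo suc p

at-ext : ∀ u v → length u ≡ length v →
  (∀ {k} → InRange (length u) k → at u k ≡ at v k) → u ≡ v
at-ext [] [] _ _ = refl
at-ext (x ∷ u) (y ∷ v) eq h = cong₂ _∷_ (h (s≤s z≤n , s≤s z≤n))
  (at-ext u v (suc-injective eq) λ { {suc k} (_ , p) → h (s≤s z≤n , s≤s p) })

at-∈ : ∀ w {k} → InRange (length w) k → at w k ∈ w
at-∈ (x ∷ w) {suc zero} _ = here refl
at-∈ (x ∷ w) {suc (suc k)} (_ , s≤s p) = there (at-∈ w (s≤s z≤n , p))

at-indexOf : ∀ {j} w → j ∈ w → InRange (length w) (indexOf j w) × at w (indexOf j w) ≡ j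
at-indexOf {j} (x ∷ w) j∈ with x ≟ j
... | yes refl rewrite ≡ᵇ-true {x} refl = (s≤s z≤n , s≤s z≤n) , refl
at-indexOf {j} (x ∷ w) (here refl) | no x≢x = contradiction refl x≢x
at-indexOf {j} (x ∷ w) (there j∈) | no x≢j rewrite ≡ᵇ-false x≢j =
  let (1≤k , k≤) , eq = at-indexOf w j∈ in
  (s≤s z≤n , s≤s k≤) , ≡-trans (at-suc x w 1≤k) eq

indexOf-at : ∀ {w k} → Unique w → InRange (length w) k → indexOf (at w k) w ≡ k
indexOf-at {x ∷ w} {suc zero} _ _ rewrite ≡ᵇ-true {x} refl = refl
indexOf-at {x ∷ w} {suc (suc k)} (x∉ ∷ u) (_ , s≤s p)
  rewrite ≡ᵇ-false (All.lookup x∉ (at-∈ w {suc k} (s≤s z≤n , p))) =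
  cong suc (indexOf-at u (s≤s z≤n , p))

module _ {m : ℕ} {w : List ℕ} (perm : IsPerm m w) where

  perm-length : length w ≡ m
  perm-length = ≡-trans (↭-length perm) (length-applyUpTo suc m)

  perm-unique : Unique w
  perm-unique = PermutationSetoid.Unique-resp-↭ (setoid ℕ) (↭⇒↭ₛ (↭-sym perm))
    (Unique.applyUpTo⁺₁ suc m λ i<j _ eq → <⇒≢ i<j (suc-injective eq))

  perm-∈⁻ : ∀ {j} → j ∈ w → InRange m j
  perm-∈⁻ j∈ with ∈-applyUpTo⁻ suc (∈-resp-↭ perm j∈)
  ... | k , k<m , refl = s≤s z≤n , k<m

  perm-∈⁺ : ∀ {j} → InRange m j → j ∈ w
  perm-∈⁺ {suc j} (_ , j<m) = ∈-resp-↭ (↭-sym perm) (∈-applyUpTo⁺ suc j<m)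

  perm-at : ∀ {k} → InRange m k → InRange m (at w k)
  perm-at p = perm-∈⁻ (at-∈ w (subst (λ l → InRange l _) (sym perm-length) p))

  perm-indexOf : ∀ {j} → InRange m j → InRange m (indexOf j w)
  perm-indexOf p =
    subst (λ l → InRange l _) perm-length (proj₁ (at-indexOf w (perm-∈⁺ p)))

  perm-at-indexOf : ∀ {j} → InRange m j → at w (indexOf j w) ≡ j
  perm-at-indexOf p = proj₂ (at-indexOf w (perm-∈⁺ p))

  perm-indexOf-at : ∀ {k} → InRange m k → indexOf (at w k) w ≡ k
  perm-indexOf-at p =
    indexOf-at perm-unique (subst (λ l → InRange l _) (sym perm-length) p)

  perm-at-injective : ∀ {j k} → InRange m j → InRange m k → at w j ≡ at w k → j ≡ k
  perm-at-injective p q eq = ≡-trans (sym (perm-indexOf-at p))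
    (≡-trans (cong (λ a → indexOf a w) eq) (perm-indexOf-at q))

  perm-at-map : ∀ (f : ℕ → ℕ) {k} → InRange m k → at (map f w) k ≡ f (at w k)
  perm-at-map f p = at-map f w (subst (λ l → InRange l _) (sym perm-length) p)

perm-range : ∀ m → IsPerm m (range m)
perm-range m = ↭-refl

perm-ext : ∀ {m u v} → IsPerm m u → IsPerm m v →
  (∀ {k} → InRange m k → at u k ≡ at v k) → u ≡ v
perm-ext {m} {u} {v} pu pv h =
  at-ext u v (≡-trans (perm-length pu) (sym (perm-length pv)))
    (λ p → h (subst (λ l → InRange l _) (perm-length pu) p))

-- Exchanging adjacent positions

-- Right multiplication by sᵢ in structural form, so that inversions can be counted by induction;
-- `comp-sgen` ties it to `comp` and `sgen`.
swapAt : ℕ → List ℕ → List ℕ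
swapAt (suc zero) (a ∷ b ∷ w) = b ∷ a ∷ w
swapAt (suc (suc i)) (x ∷ w) = x ∷ swapAt (suc i) w
swapAt _ w = w

swapAt-↭ : ∀ i w → swapAt i w ↭ w
swapAt-↭ zero w = ↭-refl
swapAt-↭ (suc zero) [] = ↭-refl
swapAt-↭ (suc zero) (a ∷ []) = ↭-refl
swapAt-↭ (suc zero) (a ∷ b ∷ w) = swap b a ↭-refl
swapAt-↭ (suc (suc i)) [] = ↭-refl
swapAt-↭ (suc (suc i)) (x ∷ w) = prep x (swapAt-↭ (suc i) w)

swapAt-involutive : ∀ i w → swapAt i (swapAt i w) ≡ w
swapAt-involutive zero w = refl
swapAt-involutive (suc zero) [] = refl
swapAt-involutive (suc zero) (a ∷ []) = refl
swapAt-involutive (suc zero) (a ∷ b ∷ w) = refl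
swapAt-involutive (suc (suc i)) [] = refl
swapAt-involutive (suc (suc i)) (x ∷ w) = cong (x ∷_) (swapAt-involutive (suc i) w)

at-swapAt : ∀ {i j} w → 1 ≤ i → i < length w → InRange (length w) j →
  at (swapAt i w) j ≡ at w (tr i j)
at-swapAt {suc zero} {suc zero} (a ∷ b ∷ w) _ _ _ = refl
at-swapAt {suc zero} {suc (suc zero)} (a ∷ b ∷ w) _ _ _ = refl
at-swapAt {suc zero} {suc (suc (suc j))} (a ∷ b ∷ w) _ _ _ = refl
at-swapAt {suc zero} (a ∷ []) _ (s≤s ()) _
at-swapAt {suc (suc i)} {suc zero} (x ∷ w) _ _ _ = refl
at-swapAt {suc (suc i)} {suc (suc j)} (x ∷ w) _ (s≤s i<) (_ , s≤s p)
  rewrite tr-suc (suc i) (suc j) =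
  ≡-trans (at-swapAt {suc i} {suc j} w (s≤s z≤n) i< (s≤s z≤n , p))
    (sym (at-suc x w (proj₁ (tr-inRange {j = suc j} (s≤s z≤n) i< (s≤s z≤n , p)))))

countLess-swapAt : ∀ x i w → countLess x (swapAt i w) ≡ countLess x w
countLess-swapAt x zero w = refl
countLess-swapAt x (suc zero) [] = refl
countLess-swapAt x (suc zero) (a ∷ []) = refl
countLess-swapAt x (suc zero) (a ∷ b ∷ w) =
  let α = if a <ᵇ x then 1 else 0; β = if b <ᵇ x then 1 else 0; γ = countLess x w in
  ≡-trans (sym (+-assoc β α γ)) (≡-trans (cong (_+ γ) (+-comm β α)) (+-assoc α β γ))
countLess-swapAt x (suc (suc i)) [] = refl
countLess-swapAt x (suc (suc i)) (y ∷ w) = cong (_ +_) (countLess-swapAt x (suc i) w)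

len-swapAt-ascent : ∀ {i} w → 1 ≤ i → i < length w → at w i < at w (suc i) →
  len (swapAt i w) ≡ suc (len w)
len-swapAt-ascent {suc zero} (a ∷ []) _ (s≤s ()) _
len-swapAt-ascent {suc zero} (a ∷ b ∷ w) _ _ a<b
  rewrite <ᵇ-true a<b | <ᵇ-false (<-asym a<b) = cong suc
  (let β = countLess b w; α = countLess a w in
   ≡-trans (sym (+-assoc β α (len w)))
     (≡-trans (cong (_+ len w) (+-comm β α)) (+-assoc α β (len w))))
len-swapAt-ascent {suc (suc i)} (x ∷ w) _ (s≤s i<) asc
  rewrite countLess-swapAt x (suc i) w
        | len-swapAt-ascent {suc i} w (s≤s z≤n) i< asc = +-suc _ _

module _ {m i : ℕ} {w : List ℕ} (perm : IsPerm m w) (1≤i : 1 ≤ i) (i<m : i < m) where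

  private
    i<len : i < length w
    i<len = subst (i <_) (sym (perm-length perm)) i<m

  perm-swapAt : IsPerm m (swapAt i w)
  perm-swapAt = ↭-trans (swapAt-↭ i w) perm

  perm-at-swapAt : ∀ {j} → InRange m j → at (swapAt i w) j ≡ at w (tr i j)
  perm-at-swapAt p =
    at-swapAt w 1≤i i<len (subst (λ l → InRange l _) (sym (perm-length perm)) p)

  at-swapAt-lower : at (swapAt i w) i ≡ at w (suc i)
  at-swapAt-lower = ≡-trans (perm-at-swapAt (lower∈ 1≤i i<m)) (cong (at w) (tr-lower i))

  at-swapAt-upper : at (swapAt i w) (suc i) ≡ at w i
  at-swapAt-upper = ≡-trans (perm-at-swapAt (upper∈ 1≤i i<m)) (cong (at w) (tr-upper i))

  len-ascent : at w i < at w (suc i) → len (swapAt i w) ≡ suc (len w)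
  len-ascent = len-swapAt-ascent w 1≤i i<len

module _ {m i : ℕ} {w : List ℕ} (perm : IsPerm m w) (1≤i : 1 ≤ i) (i<m : i < m) where

  len-descent : at w (suc i) < at w i → len w ≡ suc (len (swapAt i w))
  len-descent desc = ≡-trans (cong len (sym (swapAt-involutive i w)))
    (len-ascent (perm-swapAt perm 1≤i i<m) 1≤i i<m
      (subst₂ _<_ (sym (at-swapAt-lower perm 1≤i i<m)) (sym (at-swapAt-upper perm 1≤i i<m)) desc))

  comp-sgen : comp w (sgen (length w) i) ≡ swapAt i w
  comp-sgen rewrite perm-length perm = at-ext _ _
    (≡-trans length-comp (sym (perm-length (perm-swapAt perm 1≤i i<m))))
    λ {k} p → eq (subst (λ l → InRange l k) length-comp p)
    where
    open ≡-Reasoning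
    length-sgen : length (sgen m i) ≡ m
    length-sgen = ≡-trans (length-map (tr i) (range m)) (length-applyUpTo suc m)
    length-comp : length (comp w (sgen m i)) ≡ m
    length-comp = ≡-trans (length-map (at w) (sgen m i)) length-sgen
    eq : ∀ {k} → InRange m k → at (comp w (sgen m i)) k ≡ at (swapAt i w) k
    eq {k} p = begin
      at (comp w (sgen m i)) k
        ≡⟨ at-map (at w) (sgen m i) (subst (λ l → InRange l k) (sym length-sgen) p) ⟩
      at w (at (sgen m i) k)
        ≡⟨ cong (at w) (perm-at-map (perm-range m) (tr i) p) ⟩
      at w (tr i (at (range m) k))
        ≡⟨ cong (at w ∘ tr i) (at-range p) ⟩
      at w (tr i k)
        ≡⟨ perm-at-swapAt perm 1≤i i<m p ⟨
      at (swapAt i w) k ∎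

  demR-ascent : at w i < at w (suc i) → demR w i ≡ swapAt i w
  demR-ascent asc rewrite comp-sgen | len-ascent perm 1≤i i<m asc
    | <ᵇ-true (n<1+n (len w)) = refl

  demR-descent : at w (suc i) < at w i → demR w i ≡ w
  demR-descent desc rewrite comp-sgen | len-descent desc
    | <ᵇ-false (<-asym (n<1+n (len (swapAt i w)))) = refl

  data Adjacent : Set where
    ascent : at w i < at w (suc i) → Adjacent
    descent : at w (suc i) < at w i → Adjacent

  adjacent : Adjacent
  adjacent with <-cmp (at w i) (at w (suc i))
  ... | tri< lt _ _ = ascent lt
  ... | tri≈ _ eq _ = contradiction
    (perm-at-injective perm (lower∈ 1≤i i<m) (upper∈ 1≤i i<m) eq) (<⇒≢ (n<1+n i))
  ... | tri> _ _ gt = descent gt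

-- Exchanging adjacent values

-- Left multiplication by sᵢ, the counterpart of `swapAt`.
swapValues : ℕ → List ℕ → List ℕ
swapValues i = map (tr i)

swapValues-involutive : ∀ i w → swapValues i (swapValues i w) ≡ w
swapValues-involutive i w =
  ≡-trans (sym (map-∘ w)) (≡-trans (map-cong (tr-involutive i) w) (map-id w))

swapAt-map : ∀ (f : ℕ → ℕ) i w → swapAt i (map f w) ≡ map f (swapAt i w)
swapAt-map f zero w = refl
swapAt-map f (suc zero) [] = refl
swapAt-map f (suc zero) (a ∷ []) = refl
swapAt-map f (suc zero) (a ∷ b ∷ w) = refl
swapAt-map f (suc (suc i)) [] = refl
swapAt-map f (suc (suc i)) (x ∷ w) = cong (f x ∷_) (swapAt-map f (suc i) w)

swapValues-range : ∀ {m i} → 1 ≤ i → i < m → swapValues i (range m) ≡ swapAt i (range m)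
swapValues-range {m} {i} 1≤i i<m = at-ext _ _
  (≡-trans lengths (sym (perm-length (perm-swapAt (perm-range m) 1≤i i<m))))
  λ {k} p → eq (subst (λ l → InRange l k) lengths p)
  where
  lengths : length (swapValues i (range m)) ≡ m
  lengths = ≡-trans (length-map (tr i) (range m)) (length-applyUpTo suc m)
  eq : ∀ {k} → InRange m k → at (swapValues i (range m)) k ≡ at (swapAt i (range m)) k
  eq {k} p = begin
    at (swapValues i (range m)) k ≡⟨ perm-at-map (perm-range m) (tr i) p ⟩
    tr i (at (range m) k)         ≡⟨ cong (tr i) (at-range p) ⟩
    tr i k                        ≡⟨ at-range (tr-inRange 1≤i i<m p) ⟨
    at (range m) (tr i k)         ≡⟨ perm-at-swapAt (perm-range m) 1≤i i<m p ⟨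
    at (swapAt i (range m)) k     ∎
    where open ≡-Reasoning

perm-swapValues : ∀ {m i w} → IsPerm m w → 1 ≤ i → i < m → IsPerm m (swapValues i w)
perm-swapValues {m} {i} perm 1≤i i<m = ↭-trans (↭-map⁺ (tr i) perm)
  (↭-trans (↭-reflexive (swapValues-range 1≤i i<m)) (swapAt-↭ i (range m)))

Unmixed : ℕ → ℕ → ℕ → Set
Unmixed i x y = ¬ (x ≡ i × y ≡ suc i) × ¬ (x ≡ suc i × y ≡ i)

tr-<ᵇ : ∀ {i x y} → Unmixed i x y → (tr i y <ᵇ tr i x) ≡ (y <ᵇ x)
tr-<ᵇ {i} {x} {y} (n₁ , n₂) with y <? x
... | yes y<x with tr-mono i y<x
...   | inj₁ lt = ≡-trans (<ᵇ-true lt) (sym (<ᵇ-true y<x))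
...   | inj₂ (p , q) = contradiction (q , p) n₂
tr-<ᵇ {i} {x} {y} (n₁ , n₂) | no y≮x =
  ≡-trans (<ᵇ-false ≮) (sym (<ᵇ-false y≮x))
  where
  ≮ : ¬ (tr i y < tr i x)
  ≮ lt with tr-mono⁻ i lt
  ... | inj₁ y<x = y≮x y<x
  ... | inj₂ (p , q) = n₁ (q , p)

countLess-swapValues : ∀ {i x ys} → All (Unmixed i x) ys →
  countLess (tr i x) (swapValues i ys) ≡ countLess x ys
countLess-swapValues [] = refl
countLess-swapValues (u ∷ us) rewrite tr-<ᵇ u = cong (_ +_) (countLess-swapValues us)

len-swapValues-unmixed : ∀ {i ys} → AllPairs (Unmixed i) ys → len (swapValues i ys) ≡ len ys
len-swapValues-unmixed [] = refl
len-swapValues-unmixed (u ∷ us) = cong₂ _+_ (countLess-swapValues u) (len-swapValues-unmixed us)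

-- The entry `suc i` turns into `i` and is now counted. Any other entry is fixed by `tr i`, and
-- being different from `i` it lies below `suc i` exactly when it lies below `i`.
countLess-swapValues-mixed : ∀ {i ys} → All (i ≢_) ys → Unique ys → suc i ∈ ys →
  countLess (suc i) (swapValues i ys) ≡ suc (countLess i ys)
countLess-swapValues-mixed {i} {y ∷ ys} (i≢ ∷ i∉) (y∉ ∷ u) (here refl)
  rewrite tr-upper i | <ᵇ-true (n<1+n i) | <ᵇ-false (<-asym (n<1+n i)) =
  -- Uniqueness leaves no second `suc i` in the tail, so all its pairs with `i` are unmixed; the new
  -- head `suc i` is read as `tr i i`.
  cong suc (subst (λ x → countLess x (swapValues i ys) ≡ countLess i ys) (tr-lower i)
    (countLess-swapValues (All.map
      (λ n → (λ (_ , e) → n (sym e)) , λ (e , _) → <⇒≢ (n<1+n i) e) y∉)))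
countLess-swapValues-mixed {i} {y ∷ ys} (i≢ ∷ i∉) (y∉ ∷ u) (there 1+i∈)
  rewrite tr-other {i} (i≢ ∘ sym) (All.lookup y∉ 1+i∈)
        | countLess-swapValues-mixed i∉ u 1+i∈
  with y <? i
... | yes y<i rewrite <ᵇ-true y<i | <ᵇ-true (m<n⇒m<1+n y<i) = refl
... | no y≮i rewrite <ᵇ-false y≮i
    | <ᵇ-false {y} {suc i} (λ lt → y≮i (≤∧≢⇒< (s≤s⁻¹ lt) (i≢ ∘ sym))) = refl

data Precedes (a b : ℕ) : List ℕ → Set where
  here : ∀ {w} → b ∈ w → Precedes a b (a ∷ w)
  there : ∀ {x w} → Precedes a b w → Precedes a b (x ∷ w)

precedes-∈ : ∀ {a b w} → Precedes a b w → a ∈ w × b ∈ w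
precedes-∈ (here b∈) = here refl , there b∈
precedes-∈ (there p) = let a∈ , b∈ = precedes-∈ p in there a∈ , there b∈

indexOf-precedes : ∀ {a b} w → a ∈ w → b ∈ w → indexOf a w < indexOf b w → Precedes a b w
indexOf-precedes {a} {b} (x ∷ w) a∈ b∈ lt with x ≟ a | x ≟ b
... | yes refl | yes refl = contradiction lt (<-irrefl refl)
indexOf-precedes (x ∷ w) a∈ (here refl) lt | yes refl | no x≢b = contradiction refl x≢b
indexOf-precedes (x ∷ w) a∈ (there b∈) lt | yes refl | no x≢b = here b∈
indexOf-precedes (x ∷ w) a∈ b∈ lt | no x≢a | yes refl
  rewrite ≡ᵇ-false x≢a | ≡ᵇ-true {x} refl with s≤s () ← lt
indexOf-precedes (x ∷ w) (here refl) b∈ lt | no x≢a | no x≢b = contradiction refl x≢a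
indexOf-precedes (x ∷ w) (there a∈) (here refl) lt | no x≢a | no x≢b = contradiction refl x≢b
indexOf-precedes (x ∷ w) (there a∈) (there b∈) lt | no x≢a | no x≢b
  rewrite ≡ᵇ-false x≢a | ≡ᵇ-false x≢b = there (indexOf-precedes w a∈ b∈ (s≤s⁻¹ lt))

len-swapValues : ∀ {i w} → Unique w → Precedes i (suc i) w →
  len (swapValues i w) ≡ suc (len w)
len-swapValues {i} (i∉ ∷ u) (here {w} 1+i∈) rewrite tr-lower i
  | countLess-swapValues-mixed i∉ u 1+i∈ =
  cong (λ l → suc (countLess i w + l)) (len-swapValues-unmixed (unmixed i∉))
  where
  unmixed : ∀ {ys} → All (i ≢_) ys → AllPairs (Unmixed i) ys
  unmixed [] = []
  unmixed (y≢ ∷ ys≢) =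
    All.map (λ n → (λ (e , _) → y≢ (sym e)) , λ (_ , e) → n (sym e)) ys≢ ∷ unmixed ys≢
len-swapValues {i} (x∉ ∷ u) (there {x} {w} p)
  rewrite countLess-swapValues {i} {x} (All.universal
    (λ _ → (λ (e , _) → All.lookup x∉ (proj₁ (precedes-∈ p)) e)
         , λ (e , _) → All.lookup x∉ (proj₂ (precedes-∈ p)) e) w)
  | len-swapValues u p = +-suc _ _

-- Left Demazure multiplication by an adjacent transposition

demL : ℕ → List ℕ → List ℕ
demL i w = if indexOf i w <ᵇ indexOf (suc i) w then swapValues i w else w

demL-ascent : ∀ i w → indexOf i w < indexOf (suc i) w → demL i w ≡ swapValues i w
demL-ascent i w lt rewrite <ᵇ-true lt = refl

demL-descent : ∀ i w → indexOf (suc i) w < indexOf i w → demL i w ≡ w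
demL-descent i w gt rewrite <ᵇ-false (<-asym gt) = refl

perm-indexOf-unique : ∀ {m w j k} → IsPerm m w → InRange m k → at w k ≡ j → indexOf j w ≡ k
perm-indexOf-unique perm p refl = perm-indexOf-at perm p

module _ {m i : ℕ} {w : List ℕ} (perm : IsPerm m w) (1≤i : 1 ≤ i) (i<m : i < m) where

  indexOf-swapAt : ∀ {j} → InRange m j → indexOf j (swapAt i w) ≡ tr i (indexOf j w)
  indexOf-swapAt {j} p =
    perm-indexOf-unique (perm-swapAt perm 1≤i i<m) (tr-inRange 1≤i i<m q)
      (≡-trans (perm-at-swapAt perm 1≤i i<m (tr-inRange 1≤i i<m q))
        (≡-trans (cong (at w) (tr-involutive i _)) (perm-at-indexOf perm p)))
    where q = perm-indexOf perm p

  -- This is why `demL` may compare positions instead of lengths: with `i` standing before `suc i`,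
  -- the exchange of the two values creates just one inversion.
  len-demL-ascent : indexOf i w < indexOf (suc i) w → len (swapValues i w) ≡ suc (len w)
  len-demL-ascent lt = len-swapValues (perm-unique perm)
    (indexOf-precedes w (perm-∈⁺ perm (lower∈ 1≤i i<m)) (perm-∈⁺ perm (upper∈ 1≤i i<m)) lt)

  data AdjacentValues : Set where
    ascent : indexOf i w < indexOf (suc i) w → AdjacentValues
    descent : indexOf (suc i) w < indexOf i w → AdjacentValues

  adjacentValues : AdjacentValues
  adjacentValues with <-cmp (indexOf i w) (indexOf (suc i) w)
  ... | tri< lt _ _ = ascent lt
  ... | tri≈ _ eq _ = contradiction
    (≡-trans (sym (perm-at-indexOf perm (lower∈ 1≤i i<m)))
      (≡-trans (cong (at w) eq) (perm-at-indexOf perm (upper∈ 1≤i i<m)))) (<⇒≢ (n<1+n i))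
  ... | tri> _ _ gt = descent gt

  perm-demL : IsPerm m (demL i w)
  perm-demL with indexOf i w <ᵇ indexOf (suc i) w
  ... | true = perm-swapValues perm 1≤i i<m
  ... | false = perm

  perm-demR : IsPerm m (demR w i)
  perm-demR with adjacent perm 1≤i i<m
  ... | ascent lt rewrite demR-ascent perm 1≤i i<m lt = perm-swapAt perm 1≤i i<m
  ... | descent gt rewrite demR-descent perm 1≤i i<m gt = perm

  len-demL-≤ : len (demL i w) ≤ suc (len w)
  len-demL-≤ with adjacentValues
  ... | ascent lt rewrite demL-ascent i w lt = ≤-reflexive (len-demL-ascent lt)
  ... | descent gt rewrite demL-descent i w gt = n≤1+n _

  len-demR-≤ : len (demR w i) ≤ suc (len w)
  len-demR-≤ with adjacent perm 1≤i i<m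
  ... | ascent lt rewrite demR-ascent perm 1≤i i<m lt = ≤-reflexive (len-ascent perm 1≤i i<m lt)
  ... | descent gt rewrite demR-descent perm 1≤i i<m gt = n≤1+n _

module _ {m i j : ℕ} {w : List ℕ} (perm : IsPerm m w)
  (1≤i : 1 ≤ i) (i<m : i < m) (1≤j : 1 ≤ j) (j<m : j < m) where

  private
    a b p q : ℕ
    a = at w j
    b = at w (suc j)
    p = indexOf i w
    q = indexOf (suc i) w

    j∈ = lower∈ 1≤j j<m
    1+j∈ = upper∈ 1≤j j<m
    i∈ = lower∈ 1≤i i<m
    1+i∈ = upper∈ 1≤i i<m
    permA = perm-swapAt perm 1≤j j<m
    permV = perm-swapValues perm 1≤i i<m

    at-p : at w p ≡ i
    at-p = perm-at-indexOf perm i∈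

    at-q : at w q ≡ suc i
    at-q = perm-at-indexOf perm 1+i∈

    -- Both products exchange the same two entries.
    swap-same : a ≡ i → b ≡ suc i → swapValues i w ≡ swapAt j w
    swap-same refl b≡ = perm-ext permV permA λ {k} k∈ → begin
      at (swapValues i w) k ≡⟨ perm-at-map perm (tr i) k∈ ⟩
      tr i (at w k) ≡⟨ eq k∈ ⟩
      at w (tr j k) ≡⟨ perm-at-swapAt perm 1≤j j<m k∈ ⟨
      at (swapAt j w) k ∎
      where
      open ≡-Reasoning
      eq : ∀ {k} → InRange m k → tr i (at w k) ≡ at w (tr j k)
      eq {k} k∈ with tr j k | trView j k
      ... | _ | lower = ≡-trans (tr-lower a) (sym b≡)
      ... | _ | upper = ≡-trans (cong (tr i) b≡) (tr-upper i)
      ... | _ | other k≢j k≢1+j = tr-other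
        (k≢j ∘ perm-at-injective perm k∈ j∈)
        (λ e → k≢1+j (perm-at-injective perm k∈ 1+j∈ (≡-trans e (sym b≡))))

    ascentV : ¬ (a ≡ i × b ≡ suc i) → a < b → at (swapValues i w) j < at (swapValues i w) (suc j)
    ascentV n lt with tr-mono i lt
    ... | inj₁ lt′ = subst₂ _<_
      (sym (perm-at-map perm (tr i) j∈)) (sym (perm-at-map perm (tr i) 1+j∈)) lt′
    ... | inj₂ e = contradiction e n

    descentV : ¬ (a ≡ suc i × b ≡ i) → b < a → at (swapValues i w) (suc j) < at (swapValues i w) j
    descentV n lt with tr-mono i lt
    ... | inj₁ lt′ = subst₂ _<_
      (sym (perm-at-map perm (tr i) 1+j∈)) (sym (perm-at-map perm (tr i) j∈)) lt′
    ... | inj₂ (e , e′) = contradiction (e′ , e) n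

    ascentA : ¬ (a ≡ i × b ≡ suc i) → p < q → indexOf i (swapAt j w) < indexOf (suc i) (swapAt j w)
    ascentA n lt with tr-mono j lt
    ... | inj₁ lt′ = subst₂ _<_
      (sym (indexOf-swapAt perm 1≤j j<m i∈)) (sym (indexOf-swapAt perm 1≤j j<m 1+i∈)) lt′
    ... | inj₂ (e , e′) = contradiction
      (≡-trans (cong (at w) (sym e)) at-p , ≡-trans (cong (at w) (sym e′)) at-q) n

    descentA : ¬ (a ≡ suc i × b ≡ i) → q < p → indexOf (suc i) (swapAt j w) < indexOf i (swapAt j w)
    descentA n lt with tr-mono j lt
    ... | inj₁ lt′ = subst₂ _<_
      (sym (indexOf-swapAt perm 1≤j j<m 1+i∈)) (sym (indexOf-swapAt perm 1≤j j<m i∈)) lt′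
    ... | inj₂ (e , e′) = contradiction
      (≡-trans (cong (at w) (sym e)) at-q , ≡-trans (cong (at w) (sym e′)) at-p) n

  private
    demL-demR-unmixed : ¬ (a ≡ i × b ≡ suc i) → ¬ (a ≡ suc i × b ≡ i) →
      demR (demL i w) j ≡ demL i (demR w j)
    demL-demR-unmixed n₁ n₂ with adjacentValues perm 1≤i i<m | adjacent perm 1≤j j<m
    ... | ascent l | ascent r
      rewrite demL-ascent i w l | demR-ascent perm 1≤j j<m r
            | demR-ascent permV 1≤j j<m (ascentV n₁ r)
            | demL-ascent i (swapAt j w) (ascentA n₁ l) = swapAt-map (tr i) j w
    ... | ascent l | descent r
      rewrite demR-descent perm 1≤j j<m r | demL-ascent i w l
            | demR-descent permV 1≤j j<m (descentV n₂ r) = refl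
    ... | descent l | ascent r
      rewrite demL-descent i w l | demR-ascent perm 1≤j j<m r
            | demL-descent i (swapAt j w) (descentA n₂ l) = refl
    ... | descent l | descent r
      rewrite demR-descent perm 1≤j j<m r | demL-descent i w l
            | demR-descent perm 1≤j j<m r = refl

  -- The two actions interfere only if the positions `j`, `suc j` hold the values `i`, `suc i`. In
  -- increasing order both perform the same exchange, and whichever comes second meets a descent; in
  -- decreasing order neither acts. In every other case each exchange preserves the ascent or
  -- descent that the other one tests.
  demL-demR-comm : demR (demL i w) j ≡ demL i (demR w j)
  demL-demR-comm with a ≟ i | b ≟ suc i | a ≟ suc i | b ≟ i
  ... | yes a≡ | yes b≡ | _ | _ = begin
    demR (demL i w) j
      ≡⟨ cong (λ v → demR v j) (demL-ascent i w p<q) ⟩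
    demR (swapValues i w) j
      ≡⟨ demR-descent permV 1≤j j<m gt ⟩
    swapValues i w
      ≡⟨ swap-same a≡ b≡ ⟩
    swapAt j w
      ≡⟨ demL-descent i (swapAt j w) gt′ ⟨
    demL i (swapAt j w)
      ≡⟨ cong (demL i) (demR-ascent perm 1≤j j<m (subst₂ _<_ (sym a≡) (sym b≡) (n<1+n i))) ⟨
    demL i (demR w j) ∎
    where
    open ≡-Reasoning
    p≡ : p ≡ j
    p≡ = perm-indexOf-unique perm j∈ a≡
    q≡ : q ≡ suc j
    q≡ = perm-indexOf-unique perm 1+j∈ b≡
    p<q : p < q
    p<q = subst₂ _<_ (sym p≡) (sym q≡) (n<1+n j)
    gt : at (swapValues i w) (suc j) < at (swapValues i w) j
    gt = subst₂ _<_
      (sym (≡-trans (perm-at-map perm (tr i) 1+j∈) (≡-trans (cong (tr i) b≡) (tr-upper i))))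
      (sym (≡-trans (perm-at-map perm (tr i) j∈) (≡-trans (cong (tr i) a≡) (tr-lower i))))
      (n<1+n i)
    gt′ : indexOf (suc i) (swapAt j w) < indexOf i (swapAt j w)
    gt′ = subst₂ _<_
      (sym (≡-trans (indexOf-swapAt perm 1≤j j<m 1+i∈) (≡-trans (cong (tr j) q≡) (tr-upper j))))
      (sym (≡-trans (indexOf-swapAt perm 1≤j j<m i∈) (≡-trans (cong (tr j) p≡) (tr-lower j))))
      (n<1+n j)
  ... | _ | _ | yes a≡ | yes b≡ = begin
    demR (demL i w) j
      ≡⟨ cong (λ v → demR v j) L≡ ⟩
    demR w j
      ≡⟨ R≡ ⟩
    w
      ≡⟨ L≡ ⟨
    demL i w
      ≡⟨ cong (demL i) R≡ ⟨
    demL i (demR w j) ∎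
    where
    open ≡-Reasoning
    L≡ : demL i w ≡ w
    L≡ = demL-descent i w (subst₂ _<_ (sym (perm-indexOf-unique perm j∈ a≡))
      (sym (perm-indexOf-unique perm 1+j∈ b≡)) (n<1+n j))
    R≡ : demR w j ≡ w
    R≡ = demR-descent perm 1≤j j<m (subst₂ _<_ (sym b≡) (sym a≡) (n<1+n i))
  ... | no a≢ | _ | no a≢′ | _ = demL-demR-unmixed (a≢ ∘ proj₁) (a≢′ ∘ proj₁)
  ... | no a≢ | _ | yes _ | no b≢′ = demL-demR-unmixed (a≢ ∘ proj₁) (b≢′ ∘ proj₂)
  ... | yes _ | no b≢ | no a≢′ | _ = demL-demR-unmixed (b≢ ∘ proj₂) (a≢′ ∘ proj₁)
  ... | yes _ | no b≢ | yes _ | no b≢′ = demL-demR-unmixed (b≢ ∘ proj₂) (b≢′ ∘ proj₂)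

-- Reduced words

firstDescent-just : ∀ w {i} → firstDescent w ≡ just i →
  1 ≤ i × i < length w × at w (suc i) < at w i
firstDescent-just (a ∷ b ∷ w) eq with b <? a
firstDescent-just (a ∷ b ∷ w) eq | yes b<a rewrite <ᵇ-true b<a with refl ← eq =
  s≤s z≤n , s≤s (s≤s z≤n) , b<a
firstDescent-just (a ∷ b ∷ w) eq | no b≮a rewrite <ᵇ-false b≮a
  with firstDescent (b ∷ w) in eq′
firstDescent-just (a ∷ b ∷ w) refl | no b≮a | just k =
  let 1≤k , k< , desc = firstDescent-just (b ∷ w) eq′ in
  s≤s z≤n , s≤s k< , subst (at (b ∷ w) (suc k) <_) (sym (at-suc a (b ∷ w) 1≤k)) desc

firstDescent-nothing-∷ : ∀ a w → firstDescent (a ∷ w) ≡ nothing → Linked _≤_ (a ∷ w)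
firstDescent-nothing-∷ a [] _ = [-]
firstDescent-nothing-∷ a (b ∷ w) eq with b <? a
... | yes b<a rewrite <ᵇ-true b<a with () ← eq
... | no b≮a rewrite <ᵇ-false b≮a with firstDescent (b ∷ w) in eq′
...   | nothing = ≮⇒≥ b≮a ∷ firstDescent-nothing-∷ b w eq′

firstDescent-nothing : ∀ w → firstDescent w ≡ nothing → Linked _≤_ w
firstDescent-nothing [] _ = []
firstDescent-nothing (a ∷ w) = firstDescent-nothing-∷ a w

sorted-↭-unique : ∀ {u v} → Linked _≤_ u → Linked _≤_ v → u ↭ v → u ≡ v
sorted-↭-unique su sv u↭v = ≋⇒≡ (↗↭↗⇒≋ ≤-totalOrder su sv (↭⇒↭ₛ u↭v))

perm-sorted : ∀ {m w} → IsPerm m w → Linked _≤_ w → w ≡ range m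
perm-sorted {m} perm sorted =
  sorted-↭-unique sorted (Linked.applyUpTo⁺₂ suc m λ i → n≤1+n (suc i)) perm

-- Letters are appended at the end, the order in which `redWordF` emits them and `foldl demR`
-- consumes them. The ascent condition is what makes the word reduced.
data Reduced (m : ℕ) : List ℕ → List ℕ → Set where
  [] : Reduced m (range m) []
  snoc : ∀ {w ρ i} → Reduced m w ρ → 1 ≤ i → i < m → at w i < at w (suc i) →
    Reduced m (swapAt i w) (ρ ++ (i ∷ []))

-- Each descent that is removed costs one inversion and one unit of fuel, so fuel equal to the
-- length runs out exactly at the identity.
reduced-redWordF : ∀ {m} f w → IsPerm m w → len w ≡ f → Reduced m w (redWordF f w)
reduced-redWordF f w perm len≡ with firstDescent w in eq
reduced-redWordF zero w perm len≡ | nothing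
  rewrite perm-sorted perm (firstDescent-nothing w eq) = []
reduced-redWordF (suc f) w perm len≡ | nothing rewrite eq
  | perm-sorted perm (firstDescent-nothing w eq) = []
reduced-redWordF {m} f w perm len≡ | just i
  with 1≤i , i<len , desc ← firstDescent-just w eq = go f len≡
  where
  i<m : i < m
  i<m = subst (i <_) (perm-length perm) i<len
  perm′ : IsPerm m (swapAt i w)
  perm′ = perm-swapAt perm 1≤i i<m
  asc : at (swapAt i w) i < at (swapAt i w) (suc i)
  asc = subst₂ _<_ (sym (at-swapAt-lower perm 1≤i i<m)) (sym (at-swapAt-upper perm 1≤i i<m)) desc
  go : ∀ f → len w ≡ f → Reduced m w (redWordF f w)
  go zero len≡ with () ← ≡-trans (sym len≡) (len-descent perm 1≤i i<m desc)
  go (suc f) len≡ rewrite eq | comp-sgen perm 1≤i i<m =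
    subst (λ v → Reduced m v (redWordF f (swapAt i w) ++ (i ∷ []))) (swapAt-involutive i w)
      (snoc (reduced-redWordF f (swapAt i w) perm′
        (suc-injective (≡-trans (sym (len-descent perm 1≤i i<m desc)) len≡))) 1≤i i<m asc)

reduced : ∀ {m w} → IsPerm m w → Reduced m w (redWord w)
reduced {w = w} perm = reduced-redWordF (len w) w perm refl

reduced-perm : ∀ {m w ρ} → Reduced m w ρ → IsPerm m w
reduced-perm {m} [] = perm-range m
reduced-perm (snoc r 1≤i i<m _) = perm-swapAt (reduced-perm r) 1≤i i<m

reduced-letters : ∀ {m w ρ} → Reduced m w ρ → All (λ i → 1 ≤ i × i < m) ρ
reduced-letters [] = []
reduced-letters (snoc r 1≤i i<m _) = AllProperties.++⁺ (reduced-letters r) ((1≤i , i<m) ∷ [])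

perm-foldl-demR : ∀ {m w ρ} → IsPerm m w → All (λ i → 1 ≤ i × i < m) ρ → IsPerm m (foldl demR w ρ)
perm-foldl-demR perm [] = perm
perm-foldl-demR perm ((1≤i , i<m) ∷ vs) = perm-foldl-demR (perm-demR perm 1≤i i<m) vs

-- A left factor present at the start of a fold can be pulled out at its end, by `demL-demR-comm`
-- for each letter.
demL-foldl-demR : ∀ {m w ρ i} → IsPerm m w → 1 ≤ i → i < m → All (λ i → 1 ≤ i × i < m) ρ →
  foldl demR (demL i w) ρ ≡ demL i (foldl demR w ρ)
demL-foldl-demR perm _ _ [] = refl
demL-foldl-demR {ρ = j ∷ ρ} perm 1≤i i<m ((1≤j , j<m) ∷ vs) = ≡-trans
  (cong (λ v → foldl demR v ρ) (demL-demR-comm perm 1≤i i<m 1≤j j<m))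
  (demL-foldl-demR (perm-demR perm 1≤j j<m) 1≤i i<m vs)

foldl-demR-reduced : ∀ {m w ρ} → Reduced m w ρ → foldl demR (range m) ρ ≡ w
foldl-demR-reduced [] = refl
foldl-demR-reduced {m} (snoc {w} {ρ} {i} r 1≤i i<m asc) =
  ≡-trans (foldl-++ demR (range m) ρ (i ∷ []))
    (≡-trans (cong (λ v → demR v i) (foldl-demR-reduced r))
      (demR-ascent (reduced-perm r) 1≤i i<m asc))

-- Inverses

length-invPerm : ∀ w → length (invPerm w) ≡ length w
length-invPerm w = ≡-trans (length-map (λ j → indexOf j w) (range (length w)))
  (length-applyUpTo suc (length w))

at-invPerm : ∀ {m w j} → IsPerm m w → InRange m j → at (invPerm w) j ≡ indexOf j w
at-invPerm {m} {w} {j} perm p rewrite perm-length perm =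
  ≡-trans (perm-at-map (perm-range m) (λ k → indexOf k w) p)
    (cong (λ k → indexOf k w) (at-range p))

invPerm-range : ∀ m → invPerm (range m) ≡ range m
invPerm-range m = at-ext _ _ (length-invPerm (range m)) λ {k} p →
  let p′ = subst (λ l → InRange l k)
        (≡-trans (length-invPerm (range m)) (length-applyUpTo suc m)) p in
  ≡-trans (at-invPerm (perm-range m) p′)
    (≡-trans (perm-indexOf-unique (perm-range m) p′ (at-range p′)) (sym (at-range p′)))

-- This is (w sᵢ)⁻¹ = sᵢ w⁻¹: the right action on `w` becomes the left action on its inverse.
invPerm-swapAt : ∀ {m i w} → IsPerm m w → 1 ≤ i → i < m →
  invPerm (swapAt i w) ≡ swapValues i (invPerm w)
invPerm-swapAt {m} {i} {w} perm 1≤i i<m = at-ext _ _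
  (≡-trans lengths (sym (≡-trans (length-map (tr i) (invPerm w)) lengths′)))
  λ {k} p → eq (subst (λ l → InRange l k) lengths p)
  where
  perm′ : IsPerm m (swapAt i w)
  perm′ = perm-swapAt perm 1≤i i<m
  lengths : length (invPerm (swapAt i w)) ≡ m
  lengths = ≡-trans (length-invPerm (swapAt i w)) (perm-length perm′)
  lengths′ : length (invPerm w) ≡ m
  lengths′ = ≡-trans (length-invPerm w) (perm-length perm)
  eq : ∀ {k} → InRange m k → at (invPerm (swapAt i w)) k ≡ at (swapValues i (invPerm w)) k
  eq {k} p = begin
    at (invPerm (swapAt i w)) k
      ≡⟨ at-invPerm perm′ p ⟩
    indexOf k (swapAt i w)
      ≡⟨ indexOf-swapAt perm 1≤i i<m p ⟩
    tr i (indexOf k w)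
      ≡⟨ cong (tr i) (at-invPerm perm p) ⟨
    tr i (at (invPerm w) k)
      ≡⟨ at-map (tr i) (invPerm w) (subst (λ l → InRange l k) (sym lengths′) p) ⟨
    at (swapValues i (invPerm w)) k ∎
    where open ≡-Reasoning

perm-invPerm-reduced : ∀ {m w ρ} → Reduced m w ρ → IsPerm m (invPerm w)
perm-invPerm-reduced {m} [] rewrite invPerm-range m = perm-range m
perm-invPerm-reduced (snoc r 1≤i i<m _) rewrite invPerm-swapAt (reduced-perm r) 1≤i i<m =
  perm-swapValues (perm-invPerm-reduced r) 1≤i i<m

perm-invPerm : ∀ {m w} → IsPerm m w → IsPerm m (invPerm w)
perm-invPerm perm = perm-invPerm-reduced (reduced perm)

indexOf-invPerm : ∀ {m w k} → IsPerm m w → InRange m k → indexOf k (invPerm w) ≡ at w k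
indexOf-invPerm perm p = perm-indexOf-unique (perm-invPerm perm) (perm-at perm p)
  (≡-trans (at-invPerm perm (perm-at perm p)) (perm-indexOf-at perm p))

invPerm-involutive : ∀ {m w} → IsPerm m w → invPerm (invPerm w) ≡ w
invPerm-involutive perm = perm-ext (perm-invPerm (perm-invPerm perm)) perm λ p →
  ≡-trans (at-invPerm (perm-invPerm perm) p) (indexOf-invPerm perm p)

-- Demazure conjugation

-- The product w⁻¹ ∘ y ∘ w with the word of the right factor as a separate argument, so that an
-- induction can shorten `w` and its word together. At `y = wfpf n` and `ρ = redWord w` it is the
-- product in `InAFPF`.
twist : List ℕ → List ℕ → List ℕ → List ℕ
twist y w ρ = foldl demR (dem (invPerm w) y) ρ

module _ {m : ℕ} {y : List ℕ} (perm-y : IsPerm m y) where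

  twist-[] : twist y (range m) [] ≡ y
  twist-[] rewrite invPerm-range m = foldl-demR-reduced (reduced perm-y)

  perm-twist : ∀ {w ρ} → Reduced m w ρ → IsPerm m (twist y w ρ)
  perm-twist r = perm-foldl-demR
    (perm-foldl-demR (perm-invPerm-reduced r) (reduced-letters (reduced perm-y)))
    (reduced-letters r)

  -- Left and right Demazure multiplication commute, so the letter that is appended to the
  -- reduced word of w acts by Demazure conjugation.
  twist-snoc : ∀ {w ρ i} → Reduced m w ρ → 1 ≤ i → i < m → at w i < at w (suc i) →
    twist y (swapAt i w) (ρ ++ (i ∷ [])) ≡ demR (demL i (twist y w ρ)) i
  twist-snoc {w} {ρ} {i} r 1≤i i<m asc = begin
    foldl demR (dem (invPerm (swapAt i w)) y) (ρ ++ (i ∷ []))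
      ≡⟨ foldl-++ demR (dem (invPerm (swapAt i w)) y) ρ (i ∷ []) ⟩
    demR (foldl demR (dem (invPerm (swapAt i w)) y) ρ) i
      ≡⟨ cong (λ v → demR (foldl demR (dem v y) ρ) i) inv≡ ⟩
    demR (foldl demR (foldl demR (demL i (invPerm w)) (redWord y)) ρ) i
      ≡⟨ cong (λ v → demR (foldl demR v ρ) i)
           (demL-foldl-demR (perm-invPerm-reduced r) 1≤i i<m letters-y) ⟩
    demR (foldl demR (demL i (dem (invPerm w) y)) ρ) i
      ≡⟨ cong (λ v → demR v i) (demL-foldl-demR
           (perm-foldl-demR (perm-invPerm-reduced r) letters-y) 1≤i i<m (reduced-letters r)) ⟩
    demR (demL i (twist y w ρ)) i ∎
    where
    open ≡-Reasoning
    perm = reduced-perm r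
    letters-y = reduced-letters (reduced perm-y)
    inv≡ : invPerm (swapAt i w) ≡ demL i (invPerm w)
    inv≡ = ≡-trans (invPerm-swapAt perm 1≤i i<m)
      (sym (demL-ascent i (invPerm w) (subst₂ _<_
        (sym (indexOf-invPerm perm (lower∈ 1≤i i<m)))
        (sym (indexOf-invPerm perm (upper∈ 1≤i i<m))) asc)))

  len-twist-≤ : ∀ {w ρ} → Reduced m w ρ → len (twist y w ρ) ≤ len y + 2 * len w
  len-twist-≤ [] rewrite twist-[] = m≤m+n _ _
  len-twist-≤ (snoc {w} {ρ} {i} r 1≤i i<m asc)
    rewrite twist-snoc r 1≤i i<m asc | len-ascent (reduced-perm r) 1≤i i<m asc
          | *-suc 2 (len w) | +-suc (len y) (suc (2 * len w)) | +-suc (len y) (2 * len w) =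
    ≤-trans (len-demR-≤ (perm-demL (perm-twist r) 1≤i i<m) 1≤i i<m)
      (s≤s (≤-trans (len-demL-≤ (perm-twist r) 1≤i i<m) (s≤s (len-twist-≤ r))))

-- Arcs of a fixed-point-free involution

precedes-asym : ∀ {a b w} → Unique w → Precedes b a w →
  AllPairs (λ e f → ¬ (e ≡ a × f ≡ b)) w
precedes-asym {a} {b} (b∉ ∷ u) (here a∈) =
  All.map (λ b≢f (_ , e) → b≢f (sym e)) b∉ ∷ later b∉
  where
  later : ∀ {w} → All (b ≢_) w → AllPairs (λ e f → ¬ (e ≡ a × f ≡ b)) w
  later [] = []
  later (_ ∷ b∉) = All.map (λ b≢f (_ , e) → b≢f (sym e)) b∉ ∷ later b∉
precedes-asym (x∉ ∷ u) (there {x} {w} p) =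
  All.universal (λ f (e , _) → All.lookup x∉ (proj₂ (precedes-∈ p)) e) w ∷ precedes-asym u p

Block : Set
Block = ℕ × ℕ

flatten : List Block → List ℕ
flatten [] = []
flatten ((a , b) ∷ bs) = a ∷ b ∷ flatten bs

Arc : List ℕ → Block → Set
Arc x (a , b) = a < b × at x a ≡ b × at x b ≡ a

-- What a linear extension demands of an earlier and a later block. Nested arcs satisfy it in both
-- orders.
Compatible : Block → Block → Set
Compatible (a , b) (a′ , b′) = ¬ (a′ < a × b′ < b)

-- The blocks of u form a linear extension of the coordinatewise order on the arcs of x.
LinearExtension : List ℕ → List ℕ → Set
LinearExtension x u = ∃[ bs ] (u ≡ flatten bs × All (Arc x) bs × AllPairs Compatible bs)

data InBlock (c : ℕ) : Block → Set where
  left : ∀ {b} → InBlock c (c , b)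
  right : ∀ {a} → InBlock c (a , c)

∈-flatten⁻ : ∀ {c} bs → c ∈ flatten bs → ∃[ B ] (B ∈ bs × InBlock c B)
∈-flatten⁻ ((a , b) ∷ bs) (here refl) = _ , here refl , left
∈-flatten⁻ ((a , b) ∷ bs) (there (here refl)) = _ , here refl , right
∈-flatten⁻ ((a , b) ∷ bs) (there (there c∈)) =
  let B , B∈ , c∈B = ∈-flatten⁻ bs c∈ in B , there B∈ , c∈B

flatten-injective : ∀ bs cs → flatten bs ≡ flatten cs → bs ≡ cs
flatten-injective [] [] _ = refl
flatten-injective ((a , b) ∷ bs) ((c , d) ∷ cs) eq with ∷-injective eq
... | refl , eq′ with ∷-injective eq′
... | refl , eq″ = cong (_ ∷_) (flatten-injective bs cs eq″)

flatten-map : ∀ f bs → flatten (map (λ (a , b) → f a , f b) bs) ≡ map f (flatten bs)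
flatten-map f [] = refl
flatten-map f ((a , b) ∷ bs) = cong (λ l → f a ∷ f b ∷ l) (flatten-map f bs)

All-flatten⁻ : ∀ {P : ℕ → Set} bs → All P (flatten bs) → All (λ (a , b) → P a × P b) bs
All-flatten⁻ [] [] = []
All-flatten⁻ (_ ∷ bs) (pa ∷ pb ∷ ps) = (pa , pb) ∷ All-flatten⁻ bs ps

Across : (ℕ → ℕ → Set) → Block → Block → Set
Across R (a , b) (a′ , b′) = (R a a′ × R a b′) × (R b a′ × R b b′)

AllPairs-flatten⁻ : ∀ {R : ℕ → ℕ → Set} bs → AllPairs R (flatten bs) →
  All (λ (a , b) → R a b) bs × AllPairs (Across R) bs
AllPairs-flatten⁻ [] [] = [] , []
AllPairs-flatten⁻ (_ ∷ bs) ((rab ∷ ra) ∷ rb ∷ rs) =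
  let within , across = AllPairs-flatten⁻ bs rs in
  rab ∷ within , All.zip (All-flatten⁻ bs ra , All-flatten⁻ bs rb) ∷ across

AllPairs-zipAll : ∀ {A : Set} {P : A → Set} {R : A → A → Set} {xs} → All P xs → AllPairs R xs →
  AllPairs (λ x y → P x × P y × R x y) xs
AllPairs-zipAll [] [] = []
AllPairs-zipAll (p ∷ ps) (r ∷ rs) = All.map (p ,_) (All.zip (ps , r)) ∷ AllPairs-zipAll ps rs

AllPairs-lookup : ∀ {A : Set} {R : A → A → Set} {xs x y} → AllPairs R xs → x ∈ xs → y ∈ xs →
  x ≡ y ⊎ R x y ⊎ R y x
AllPairs-lookup (r ∷ rs) (here refl) (here refl) = inj₁ refl
AllPairs-lookup (r ∷ rs) (here refl) (there y∈) = inj₂ (inj₁ (All.lookup r y∈))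
AllPairs-lookup (r ∷ rs) (there x∈) (here refl) = inj₂ (inj₂ (All.lookup r x∈))
AllPairs-lookup (r ∷ rs) (there x∈) (there y∈) = AllPairs-lookup rs x∈ y∈

-- Every value is an endpoint of some block, so the arcs alone force `x` to be an involution. This
-- supplies involutivity for the intermediate products of the induction.
linearExtension-involutive : ∀ {m x u j} → IsPerm m u → LinearExtension x u → InRange m j →
  at x (at x j) ≡ j
linearExtension-involutive {x = x} perm (bs , refl , arcs , _) p
  with ∈-flatten⁻ bs (perm-∈⁺ perm p)
... | B , B∈ , left = let _ , xa , xb = All.lookup arcs B∈ in ≡-trans (cong (at x) xa) xb
... | B , B∈ , right = let _ , xa , xb = All.lookup arcs B∈ in ≡-trans (cong (at x) xb) xa

-- For an involution the positions that `demL` compares are values of `x`, so its left ascents and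
-- right ascents coincide.
linearExtension-indexOf : ∀ {m x u j} → IsPerm m x → IsPerm m u → LinearExtension x u →
  InRange m j → indexOf j x ≡ at x j
linearExtension-indexOf {x = x} px pu ext p =
  perm-indexOf-unique px (perm-at px p) (linearExtension-involutive {x = x} pu ext p)

arcs-unique : ∀ {m x y bs} → IsPerm m (flatten bs) → IsPerm m x → IsPerm m y →
  All (Arc x) bs → All (Arc y) bs → x ≡ y
arcs-unique {m} {x} {y} {bs} perm px py ax ay = perm-ext px py eq
  where
  eq : ∀ {j} → InRange m j → at x j ≡ at y j
  eq p with ∈-flatten⁻ bs (perm-∈⁺ perm p)
  ... | B , B∈ , left =
    ≡-trans (proj₁ (proj₂ (All.lookup ax B∈))) (sym (proj₁ (proj₂ (All.lookup ay B∈))))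
  ... | B , B∈ , right =
    ≡-trans (proj₂ (proj₂ (All.lookup ax B∈))) (sym (proj₂ (proj₂ (All.lookup ay B∈))))

linearExtension-unique : ∀ {m x y u} → IsPerm m u → IsPerm m x → IsPerm m y →
  LinearExtension x u → LinearExtension y u → x ≡ y
linearExtension-unique perm px py (bs , refl , ax , _) (cs , eq , ay , _)
  with refl ← flatten-injective bs cs eq = arcs-unique perm px py ax ay

-- Conjugating an involution and its blocks by an adjacent transposition

trBlock : ℕ → Block → Block
trBlock i (a , b) = tr i a , tr i b

conjugate : ℕ → List ℕ → List ℕ
conjugate i x = swapAt i (swapValues i x)

conjugate-involutive : ∀ i x → conjugate i (conjugate i x) ≡ x
conjugate-involutive i x = begin
  swapAt i (swapValues i (swapAt i (swapValues i x)))
    ≡⟨ cong (swapAt i) (swapAt-map (tr i) i (swapValues i x)) ⟨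
  swapAt i (swapAt i (swapValues i (swapValues i x)))
    ≡⟨ swapAt-involutive i _ ⟩
  swapValues i (swapValues i x)
    ≡⟨ swapValues-involutive i x ⟩
  x ∎
  where open ≡-Reasoning

module _ {m i : ℕ} (1≤i : 1 ≤ i) (i<m : i < m) where

  perm-conjugate : ∀ {x} → IsPerm m x → IsPerm m (conjugate i x)
  perm-conjugate px = perm-swapAt (perm-swapValues px 1≤i i<m) 1≤i i<m

  at-conjugate : ∀ {x j} → IsPerm m x → InRange m j → at (conjugate i x) j ≡ tr i (at x (tr i j))
  at-conjugate px p = ≡-trans (perm-at-swapAt (perm-swapValues px 1≤i i<m) 1≤i i<m p)
    (perm-at-map px (tr i) (tr-inRange 1≤i i<m p))

  -- The arc `(i , suc i)` must be excluded because `tr i` would put its endpoints in the wrong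
  -- order.
  arc-conjugate : ∀ {x a b} → IsPerm m x → InRange m a → InRange m b →
    ¬ (a ≡ i × b ≡ suc i) → Arc x (a , b) → Arc (conjugate i x) (trBlock i (a , b))
  arc-conjugate {x} {a} {b} px a∈ b∈ n (a<b , xa , xb) with tr-mono i a<b
  ... | inj₂ e = contradiction e n
  ... | inj₁ lt = lt , image xa a∈ , image xb b∈
    where
    image : ∀ {a b} → at x a ≡ b → InRange m a → at (conjugate i x) (tr i a) ≡ tr i b
    image {a} xa a∈ = ≡-trans (at-conjugate px (tr-inRange 1≤i i<m a∈))
      (cong (tr i) (≡-trans (cong (at x) (tr-involutive i a)) xa))

  linearExtension-conjugate : ∀ {x bs} → IsPerm m x → IsPerm m (flatten bs) → All (Arc x) bs →
    All (λ (a , b) → ¬ (a ≡ i × b ≡ suc i)) bs →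
    AllPairs (λ B B′ → Compatible (trBlock i B) (trBlock i B′)) bs →
    LinearExtension (conjugate i x) (swapValues i (flatten bs))
  linearExtension-conjugate {x} {bs} px perm arcs n compat =
    map (trBlock i) bs , sym (flatten-map (tr i) bs) ,
    AllProperties.map⁺ (All.map (λ ((a∈ , b∈) , n , arc) → arc-conjugate px a∈ b∈ n arc)
      (All.zip (ranges , All.zip (n , arcs)))) ,
    AllPairsProperties.map⁺ compat
    where
    ranges : All (λ (a , b) → InRange m a × InRange m b) bs
    ranges = All-flatten⁻ bs (All.tabulate (perm-∈⁻ perm))

  module _ {x : List ℕ} (px : IsPerm m x) (bs : List Block) (perm : IsPerm m (flatten bs))
    (arcs : All (Arc x) bs) (compat : AllPairs Compatible bs) where

    -- The ascent of `x` enters twice. It rules out the arc `(i , suc i)`; and if `tr i` newly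
    -- orders two blocks the wrong way in one coordinate, that coordinate holds `i` and `suc i`,
    -- whose partners the ascent orders against the comparison in the other coordinate.
    linearExtension-ascend : at x i < at x (suc i) →
      LinearExtension (conjugate i x) (swapValues i (flatten bs))
    linearExtension-ascend asc = linearExtension-conjugate px perm arcs
      (All.map notArc arcs) (AllPairs.map keep (AllPairs-zipAll arcs compat))
      where
      notArc : ∀ {B} → Arc x B → ¬ (proj₁ B ≡ i × proj₂ B ≡ suc i)
      notArc (_ , xa , xb) (refl , refl) = <-asym (n<1+n i) (subst₂ _<_ xa xb asc)
      keep : ∀ {B B′} → Arc x B × Arc x B′ × Compatible B B′ →
        Compatible (trBlock i B) (trBlock i B′)
      keep ((a<b , xa , xb) , (a<b′ , xa′ , xb′) , c) (lt , lt′)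
        with tr-mono⁻ i lt | tr-mono⁻ i lt′
      ... | inj₁ p | inj₁ q = c (p , q)
      ... | inj₁ p | inj₂ (refl , refl) = <-asym p (subst₂ _<_ xb xb′ asc)
      ... | inj₂ (refl , refl) | inj₁ q = <-asym q (subst₂ _<_ xa xa′ asc)
      ... | inj₂ (refl , refl) | inj₂ (refl , refl) = <-irrefl refl a<b

    module _ (before : Precedes (suc i) i (flatten bs)) where

      private
        Separated : ℕ → ℕ → Set
        Separated e f = ¬ (e ≡ i × f ≡ suc i)

        separated : All (λ (a , b) → Separated a b) bs × AllPairs (Across Separated) bs
        separated = AllPairs-flatten⁻ bs (precedes-asym (perm-unique perm) before)

      -- A forbidden comparison could only be created by an `i` in an earlier block facing a `suc i`
      -- in a later one, and `before` excludes this. It also excludes the arc `(i , suc i)`.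
      linearExtension-descend : LinearExtension (conjugate i x) (swapValues i (flatten bs))
      linearExtension-descend = linearExtension-conjugate px perm arcs (proj₁ separated)
        (AllPairs.map keep (AllPairs.zip (compat , proj₂ separated)))
        where
        keep : ∀ {B B′} → Compatible B B′ × Across Separated B B′ →
          Compatible (trBlock i B) (trBlock i B′)
        keep (c , (aa′ , _) , (_ , bb′)) (lt , lt′) with tr-mono⁻ i lt | tr-mono⁻ i lt′
        ... | inj₁ p | inj₁ q = c (p , q)
        ... | inj₁ _ | inj₂ (p , q) = bb′ (q , p)
        ... | inj₂ (p , q) | _ = aa′ (q , p)

      -- The two facts make conjugation by sᵢ lower the length on both sides: the first is the
      -- descent itself, the second keeps the other multiplication from undoing it. The proof
      -- distinguishes which endpoints of their arcs `suc i` and `i` are.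
      linearExtension-descent : at x (suc i) < at x i × at x i ≢ suc i
      linearExtension-descent
        with ∈-flatten⁻ bs (perm-∈⁺ perm (upper∈ 1≤i i<m))
           | ∈-flatten⁻ bs (perm-∈⁺ perm (lower∈ 1≤i i<m))
      ... | (a , b) , B∈ , upper∈B | (a′ , b′) , B′∈ , lower∈B′ =
        order upper∈B lower∈B′
          (AllPairs-lookup (AllPairs.zip (compat , proj₂ separated)) B∈ B′∈) ,
        unmatched lower∈B′
        where
        arc = All.lookup arcs B∈
        arc′ = All.lookup arcs B′∈
        unmatched : InBlock i (a′ , b′) → at x i ≢ suc i
        unmatched left e =
          All.lookup (proj₁ separated) B′∈ (refl , ≡-trans (sym (proj₁ (proj₂ arc′))) e)
        unmatched right e = <-asym (n<1+n i)
          (subst (_< i) (≡-trans (sym (proj₂ (proj₂ arc′))) e) (proj₁ arc′))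
        order : InBlock (suc i) (a , b) → InBlock i (a′ , b′) →
          (a , b) ≡ (a′ , b′) ⊎ (Compatible (a , b) (a′ , b′) × Across Separated (a , b) (a′ , b′))
            ⊎ (Compatible (a′ , b′) (a , b) × Across Separated (a′ , b′) (a , b)) →
          at x (suc i) < at x i
        order left right (inj₁ refl) = contradiction (proj₁ arc) (<-asym (n<1+n i))
        order right left (inj₁ refl) =
          contradiction (refl , refl) (All.lookup (proj₁ separated) B∈)
        order left left (inj₂ (inj₂ (_ , (n , _) , _))) = contradiction (refl , refl) n
        order left right (inj₂ (inj₂ (_ , _ , (n , _)))) = contradiction (refl , refl) n
        order right left (inj₂ (inj₂ (_ , (_ , n) , _))) = contradiction (refl , refl) n
        order right right (inj₂ (inj₂ (_ , _ , (_ , n)))) = contradiction (refl , refl) n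
        order left left (inj₂ (inj₁ (c , _))) =
          let _ , xa , xb = arc; _ , xa′ , xb′ = arc′ in
          subst₂ _<_ (sym xa) (sym xa′) (≤∧≢⇒< (≮⇒≥ λ lt → c (n<1+n i , lt))
            λ e → <⇒≢ (n<1+n i) (≡-trans (sym xb′) (≡-trans (cong (at x) (sym e)) xb)))
        -- The later arc `(a′ , i)` would lie wholly to the left of the earlier arc `(suc i , b)`,
        -- which compatibility forbids.
        order left right (inj₂ (inj₁ (c , _))) =
          contradiction (m<n⇒m<1+n (proj₁ arc′) , <-trans (n<1+n i) (proj₁ arc)) c
        order right left (inj₂ (inj₁ _)) =
          let a<b , xa , xb = arc; a<b′ , xa′ , xb′ = arc′ in
          subst₂ _<_ (sym xb) (sym xa′) (<-≤-trans a<b a<b′)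
        order right right (inj₂ (inj₁ (c , _))) =
          let _ , xa , xb = arc; _ , xa′ , xb′ = arc′ in
          subst₂ _<_ (sym xb) (sym xb′) (≤∧≢⇒< (≮⇒≥ λ lt → c (lt , n<1+n i))
            λ e → <⇒≢ (n<1+n i) (≡-trans (sym xa′) (≡-trans (cong (at x) (sym e)) xa)))

linearExtension-ascendValues : ∀ {m i z u} → IsPerm m z → IsPerm m u → 1 ≤ i → i < m →
  LinearExtension z u → indexOf i z < indexOf (suc i) z →
  LinearExtension (conjugate i z) (swapValues i u)
linearExtension-ascendValues pz pu 1≤i i<m ext@(bs , refl , arcs , compat) lt =
  linearExtension-ascend 1≤i i<m pz bs pu arcs compat (subst₂ _<_
    (linearExtension-indexOf pz pu ext (lower∈ 1≤i i<m))
    (linearExtension-indexOf pz pu ext (upper∈ 1≤i i<m)) lt)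

countLess-≤ : ∀ {x ys} → All (x ≤_) ys → countLess x ys ≡ 0
countLess-≤ [] = refl
countLess-≤ (x≤y ∷ ps) rewrite <ᵇ-false (≤⇒≯ x≤y) = countLess-≤ ps

len-sorted : ∀ {ys} → AllPairs _≤_ ys → len ys ≡ 0
len-sorted [] = refl
len-sorted (p ∷ ps) rewrite countLess-≤ p = len-sorted ps

len-range : ∀ m → len (range m) ≡ 0
len-range m = len-sorted (AllPairsProperties.applyUpTo⁺₁ suc m λ i<j _ → s≤s (<⇒≤ i<j))

-- Atoms

module _ {m : ℕ} {y : List ℕ} (perm-y : IsPerm m y) (base : LinearExtension y (range m)) where

  private
    2*-suc : ∀ c l → c + 2 * suc l ≡ suc (suc (c + 2 * l))
    2*-suc c l rewrite *-suc 2 l | +-suc c (suc (2 * l)) | +-suc c (2 * l) = refl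

  -- Peel off the last letter `i`. In the inverse of `swapAt i w` the value `suc i` stands before
  -- `i`, so `x` descends at `i` and `conjugate i x` has `invPerm w` as a linear extension. On the
  -- way back both multiplications by sᵢ are ascents, which restores `x` and adds 2 to the length.
  linearExtension⇒twist : ∀ {w ρ x} → Reduced m w ρ → IsPerm m x →
    LinearExtension x (invPerm w) → twist y w ρ ≡ x × len x ≡ len y + 2 * len w
  linearExtension⇒twist {x = x} [] px ext rewrite twist-[] perm-y | invPerm-range m
    | linearExtension-unique (perm-range m) px perm-y ext base | len-range m =
    refl , sym (+-identityʳ _)
  linearExtension⇒twist {x = x} (snoc {w} {ρ} {i} r 1≤i i<m asc) px (bs , eq , arcs , compat)
    = twist≡x , len≡
    where
    perm-w = reduced-perm r
    perm-w′ = perm-swapAt perm-w 1≤i i<m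
    perm-bs : IsPerm m (flatten bs)
    perm-bs = subst (IsPerm m) eq (perm-invPerm perm-w′)
    before : Precedes (suc i) i (flatten bs)
    before = subst (Precedes (suc i) i) eq (indexOf-precedes (invPerm (swapAt i w))
      (perm-∈⁺ (perm-invPerm perm-w′) (upper∈ 1≤i i<m))
      (perm-∈⁺ (perm-invPerm perm-w′) (lower∈ 1≤i i<m))
      (subst₂ _<_
        (sym (≡-trans (indexOf-invPerm perm-w′ (upper∈ 1≤i i<m)) (at-swapAt-upper perm-w 1≤i i<m)))
        (sym (≡-trans (indexOf-invPerm perm-w′ (lower∈ 1≤i i<m)) (at-swapAt-lower perm-w 1≤i i<m)))
        asc))
    x′ = conjugate i x
    px′ : IsPerm m x′
    px′ = perm-conjugate 1≤i i<m px
    ext′ : LinearExtension x′ (invPerm w)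
    ext′ = subst (LinearExtension x′)
      (≡-trans (cong (swapValues i) (≡-trans (sym eq) (invPerm-swapAt perm-w 1≤i i<m)))
        (swapValues-involutive i (invPerm w)))
      (linearExtension-descend 1≤i i<m px bs perm-bs arcs compat before)
    desc = linearExtension-descent 1≤i i<m px bs perm-bs arcs compat before
    IH : twist y w ρ ≡ x′ × len x′ ≡ len y + 2 * len w
    IH = linearExtension⇒twist r px′ ext′
    perm-inv : IsPerm m (invPerm w)
    perm-inv = perm-invPerm perm-w
    indexOf-x′ : ∀ {j} → InRange m j → indexOf j x′ ≡ tr i (at x (tr i j))
    indexOf-x′ p = ≡-trans (linearExtension-indexOf px′ perm-inv ext′ p) (at-conjugate 1≤i i<m px p)
    -- `tr i` could reverse this only if `x` matched `i` with `suc i`.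
    tr-desc : tr i (at x (suc i)) < tr i (at x i)
    tr-desc with tr-mono i (proj₁ desc)
    ... | inj₁ lt = lt
    ... | inj₂ (_ , e) = contradiction e (proj₂ desc)
    ascL : indexOf i x′ < indexOf (suc i) x′
    ascL = subst₂ _<_
      (sym (≡-trans (indexOf-x′ (lower∈ 1≤i i<m)) (cong (λ j → tr i (at x j)) (tr-lower i))))
      (sym (≡-trans (indexOf-x′ (upper∈ 1≤i i<m)) (cong (λ j → tr i (at x j)) (tr-upper i))))
      tr-desc
    -- With x′ = sᵢ x sᵢ this is sᵢ x′ = x sᵢ.
    z≡ : swapValues i x′ ≡ swapAt i x
    z≡ = ≡-trans (sym (swapAt-involutive i (swapValues i x′)))
      (cong (swapAt i) (conjugate-involutive i x))
    pz : IsPerm m (swapAt i x)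
    pz = perm-swapAt px 1≤i i<m
    ascR : at (swapAt i x) i < at (swapAt i x) (suc i)
    ascR = subst₂ _<_ (sym (at-swapAt-lower px 1≤i i<m)) (sym (at-swapAt-upper px 1≤i i<m))
      (proj₁ desc)
    twist≡x : twist y (swapAt i w) (ρ ++ (i ∷ [])) ≡ x
    twist≡x = begin
      twist y (swapAt i w) (ρ ++ (i ∷ []))   ≡⟨ twist-snoc perm-y r 1≤i i<m asc ⟩
      demR (demL i (twist y w ρ)) i       ≡⟨ cong (λ v → demR (demL i v) i) (proj₁ IH) ⟩
      demR (demL i x′) i                  ≡⟨ cong (λ v → demR v i) (demL-ascent i x′ ascL) ⟩
      demR (swapValues i x′) i            ≡⟨ cong (λ v → demR v i) z≡ ⟩
      demR (swapAt i x) i                 ≡⟨ demR-ascent pz 1≤i i<m ascR ⟩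
      swapAt i (swapAt i x)               ≡⟨ swapAt-involutive i x ⟩
      x                                   ∎
      where open ≡-Reasoning
    len≡ : len x ≡ len y + 2 * len (swapAt i w)
    len≡ = begin
      len x                               ≡⟨ len-descent px 1≤i i<m (proj₁ desc) ⟩
      suc (len (swapAt i x))              ≡⟨ cong (suc ∘ len) z≡ ⟨
      suc (len (swapValues i x′))         ≡⟨ cong suc (len-demL-ascent px′ 1≤i i<m ascL) ⟩
      suc (suc (len x′))                  ≡⟨ cong (suc ∘ suc) (proj₂ IH) ⟩
      suc (suc (len y + 2 * len w))       ≡⟨ 2*-suc (len y) (len w) ⟨
      len y + 2 * suc (len w)
        ≡⟨ cong (λ l → len y + 2 * l) (len-ascent perm-w 1≤i i<m asc) ⟨
      len y + 2 * len (swapAt i w)        ∎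
      where open ≡-Reasoning

  -- Equality forces every letter to add 2. A descent on either side would leave a gain of at most
  -- 1, contradicting `len-twist-≤` for the shorter word; so each letter is a plain conjugation
  -- along an ascent, and this carries linear extensions along.
  twist⇒linearExtension : ∀ {w ρ} → Reduced m w ρ → len (twist y w ρ) ≡ len y + 2 * len w →
    LinearExtension (twist y w ρ) (invPerm w)
  twist⇒linearExtension [] _ rewrite twist-[] perm-y | invPerm-range m = base
  twist⇒linearExtension (snoc {w} {ρ} {i} r 1≤i i<m asc) len≡
    rewrite twist-snoc perm-y r 1≤i i<m asc | invPerm-swapAt (reduced-perm r) 1≤i i<m
          | len-ascent (reduced-perm r) 1≤i i<m asc | 2*-suc (len y) (len w)
    with adjacentValues (perm-twist perm-y r) 1≤i i<m
  ... | descent gt rewrite demL-descent i (twist y w ρ) gt =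
    contradiction (≤-trans (≤-reflexive (sym len≡))
      (≤-trans (len-demR-≤ (perm-twist perm-y r) 1≤i i<m) (s≤s (len-twist-≤ perm-y r)))) 1+n≰n
  ... | ascent lt rewrite demL-ascent i (twist y w ρ) lt
    with adjacent (perm-swapValues (perm-twist perm-y r) 1≤i i<m) 1≤i i<m
  ...   | descent gt rewrite demR-descent (perm-swapValues (perm-twist perm-y r) 1≤i i<m) 1≤i i<m gt
        | len-demL-ascent (perm-twist perm-y r) 1≤i i<m lt =
    contradiction (≤-trans (≤-reflexive (sym len≡)) (s≤s (len-twist-≤ perm-y r))) 1+n≰n
  ...   | ascent lt′ rewrite demR-ascent (perm-swapValues (perm-twist perm-y r) 1≤i i<m) 1≤i i<m lt′
        | len-ascent (perm-swapValues (perm-twist perm-y r) 1≤i i<m) 1≤i i<m lt′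
        | len-demL-ascent (perm-twist perm-y r) 1≤i i<m lt =
    linearExtension-ascendValues (perm-twist perm-y r) (perm-invPerm-reduced r) 1≤i i<m
      (twist⇒linearExtension r (suc-injective (suc-injective len≡))) lt

-- The base point

applyUpTo-cong : ∀ {A : Set} {f g : ℕ → A} → (∀ k → f k ≡ g k) → ∀ n → applyUpTo f n ≡ applyUpTo g n
applyUpTo-cong h zero = refl
applyUpTo-cong h (suc n) = cong₂ _∷_ (h 0) (applyUpTo-cong (h ∘ suc) n)

flatten-applyUpTo : ∀ (f : ℕ → ℕ) n →
  flatten (applyUpTo (λ k → f (2 * k) , f (suc (2 * k))) n) ≡ applyUpTo f (2 * n)
flatten-applyUpTo f zero = refl
flatten-applyUpTo f (suc n) rewrite +-suc n (n + 0) = cong (λ l → f 0 ∷ f 1 ∷ l)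
  (≡-trans (cong flatten (applyUpTo-cong
      (λ k → cong (λ j → f j , f (suc j)) (*-suc 2 k)) n))
    (flatten-applyUpTo (f ∘ suc ∘ suc) n))

comp-sgen-left : ∀ {m i w} → IsPerm m w → comp (sgen m i) w ≡ swapValues i w
comp-sgen-left {m} {i} {w} perm = map-cong-local (All.tabulate λ j∈ →
  let p = perm-∈⁻ perm j∈ in
  ≡-trans (perm-at-map (perm-range m) (tr i) p) (cong (tr i) (at-range p)))

module _ (n : ℕ) where

  private
    m = 2 * n

    odd<m : ∀ {k} → k < n → suc (2 * k) < m
    odd<m {k} k<n = subst (_≤ m) (*-suc 2 k) (*-monoʳ-≤ 2 k<n)

    tr-odd : ∀ {k l} → l ≢ k → tr (suc (2 * l)) (suc (2 * k)) ≡ suc (2 * k)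
    tr-odd {k} {l} l≢k = tr-other (λ e → l≢k (*-cancelˡ-≡ l k 2 (sym (suc-injective e))))
      (λ e → even≢odd k l (suc-injective e))

    tr-even : ∀ {k l} → l ≢ k → tr (suc (2 * l)) (suc (suc (2 * k))) ≡ suc (suc (2 * k))
    tr-even {k} {l} l≢k = tr-other (λ e → even≢odd l k (suc-injective (sym e)))
      (λ e → l≢k (*-cancelˡ-≡ l k 2 (sym (suc-injective (suc-injective e)))))

    product : List ℕ → List ℕ
    product ks = foldr comp (range m) (map (λ k → sgen m (suc (2 * k))) ks)

    perm-product : ∀ {ks} → All (_< n) ks → IsPerm m (product ks)
    perm-product [] = perm-range m
    perm-product {k ∷ ks} (k<n ∷ ks<n) = subst (IsPerm m)
      (sym (comp-sgen-left (perm-product ks<n)))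
      (perm-swapValues (perm-product ks<n) (s≤s z≤n) (odd<m k<n))

    at-product : ∀ {k ks j} → All (_< n) (k ∷ ks) → InRange m j →
      at (product (k ∷ ks)) j ≡ tr (suc (2 * k)) (at (product ks) j)
    at-product {k} {ks} {j} (_ ∷ ks<n) p = ≡-trans
      (cong (λ w → at w j) (comp-sgen-left (perm-product ks<n)))
      (perm-at-map (perm-product ks<n) (tr (suc (2 * k))) p)

    odd∈ : ∀ {k} → k < n → InRange m (suc (2 * k))
    odd∈ k<n = s≤s z≤n , <⇒≤ (odd<m k<n)

    even∈ : ∀ {k} → k < n → InRange m (suc (suc (2 * k)))
    even∈ k<n = s≤s z≤n , odd<m k<n

    -- Factors with different indices exchange disjoint pairs of the form `2k+1`, `2k+2`; parity
    -- keeps neighbouring pairs apart.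
    product-fixed : ∀ {k ks} → k < n → All (_< n) ks → All (_≢ k) ks →
      at (product ks) (suc (2 * k)) ≡ suc (2 * k) ×
      at (product ks) (suc (suc (2 * k))) ≡ suc (suc (2 * k))
    product-fixed k<n [] [] = at-range (odd∈ k<n) , at-range (even∈ k<n)
    product-fixed {k} {l ∷ ks} k<n ks<n@(_ ∷ ks<n′) (l≢k ∷ ks≢k) =
      let odd , even = product-fixed k<n ks<n′ ks≢k in
      ≡-trans (at-product ks<n (odd∈ k<n)) (≡-trans (cong (tr (suc (2 * l))) odd) (tr-odd l≢k)) ,
      ≡-trans (at-product ks<n (even∈ k<n)) (≡-trans (cong (tr (suc (2 * l))) even) (tr-even l≢k))

    product-moved : ∀ {k ks} → k < n → All (_< n) ks → Unique ks → k ∈ ks →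
      at (product ks) (suc (2 * k)) ≡ suc (suc (2 * k)) ×
      at (product ks) (suc (suc (2 * k))) ≡ suc (2 * k)
    product-moved {k} {k ∷ ks} k<n ks<n@(_ ∷ ks<n′) (k∉ ∷ u) (here refl) =
      let odd , even = product-fixed k<n ks<n′ (All.map (_∘ sym) k∉) in
      ≡-trans (at-product ks<n (odd∈ k<n))
        (≡-trans (cong (tr (suc (2 * k))) odd) (tr-lower (suc (2 * k)))) ,
      ≡-trans (at-product ks<n (even∈ k<n))
        (≡-trans (cong (tr (suc (2 * k))) even) (tr-upper (suc (2 * k))))
    product-moved {k} {l ∷ ks} k<n ks<n@(_ ∷ ks<n′) (l∉ ∷ u) (there k∈) =
      let odd , even = product-moved k<n ks<n′ u k∈
          l≢k = All.lookup l∉ k∈ in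
      ≡-trans (at-product ks<n (odd∈ k<n)) (≡-trans (cong (tr (suc (2 * l))) odd) (tr-even l≢k)) ,
      ≡-trans (at-product ks<n (even∈ k<n)) (≡-trans (cong (tr (suc (2 * l))) even) (tr-odd l≢k))

    upTo< : All (_< n) (upTo n)
    upTo< = AllProperties.applyUpTo⁺₁ id n id

  perm-wfpf : IsPerm m (wfpf n)
  perm-wfpf = perm-product upTo<

  linearExtension-wfpf : LinearExtension (wfpf n) (range m)
  linearExtension-wfpf =
    applyUpTo (λ k → suc (2 * k) , suc (suc (2 * k))) n ,
    sym (flatten-applyUpTo suc n) ,
    AllProperties.applyUpTo⁺₁ _ n (λ {k} k<n →
      n<1+n (suc (2 * k)) , product-moved k<n upTo< (Unique.upTo⁺ n) (∈-applyUpTo⁺ id k<n)) ,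
    AllPairsProperties.applyUpTo⁺₁ _ n
      (λ i<j _ (lt , _) → <⇒≱ lt (s≤s (*-monoʳ-≤ 2 (<⇒≤ i<j))))

-- Sorting the blocks

≼-refl : ∀ {u} → u ≼ u
≼-refl = inj₂ refl

≼-trans : ∀ {u v w} → u ≼ v → v ≼ w → u ≼ w
≼-trans (inj₁ p) (inj₁ q) = inj₁ (p ⁺++⁺ q)
≼-trans (inj₁ p) (inj₂ refl) = inj₁ p
≼-trans (inj₂ refl) q = q

step-∷∷ : ∀ {u v} a b → Step u v → Step (a ∷ b ∷ u) (a ∷ b ∷ v)
step-∷∷ a b (step pre k _ _ _ _ suf eq p q r) =
  step (a ∷ b ∷ pre) (suc k) _ _ _ _ suf
    (≡-trans (cong (λ l → suc (suc l)) eq) (sym (*-suc 2 k))) p q r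

≼-∷∷ : ∀ {u v} a b → u ≼ v → (a ∷ b ∷ u) ≼ (a ∷ b ∷ v)
≼-∷∷ a b (inj₁ p) = inj₁ (go p)
  where
  go : ∀ {u v} → u ≺ v → (a ∷ b ∷ u) ≺ (a ∷ b ∷ v)
  go [ s ] = [ step-∷∷ a b s ]
  go (s ∷ p) = step-∷∷ a b s ∷ go p
≼-∷∷ a b (inj₂ refl) = ≼-refl

-- The relation is a parameter so that one sort serves both extremes: by left endpoints it moves
-- down in `_≼_`, by right endpoints it moves up. Each exchange brings a block with smaller key
-- forward past a compatible one.
module InsertionSort
  (key : Block → ℕ) (_⊑_ : List ℕ → List ℕ → Set)
  (⊑-refl : ∀ {u} → u ⊑ u)
  (⊑-trans : ∀ {u v w} → u ⊑ v → v ⊑ w → u ⊑ w)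
  (⊑-∷∷ : ∀ {u v} a b → u ⊑ v → (a ∷ b ∷ u) ⊑ (a ∷ b ∷ v))
  (⊑-exchange : ∀ {a b a′ b′} bs → a < b → a′ < b′ → Compatible (a , b) (a′ , b′) →
    key (a′ , b′) < key (a , b) →
    flatten ((a′ , b′) ∷ (a , b) ∷ bs) ⊑ flatten ((a , b) ∷ (a′ , b′) ∷ bs))
  where

  Rising : Block → Set
  Rising (a , b) = a < b

  Sorted : List Block → Set
  Sorted = AllPairs (λ B B′ → key B ≤ key B′)

  insert : ∀ B bs → Rising B → All Rising bs → All (Compatible B) bs → Sorted bs →
    ∃[ cs ] (Sorted cs × cs ↭ B ∷ bs × flatten cs ⊑ flatten (B ∷ bs))
  insert B [] _ _ _ _ = B ∷ [] , [] ∷ [] , ↭-refl , ⊑-refl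
  insert B (B′ ∷ bs) r (r′ ∷ rs) (c ∷ cs) (s ∷ ss) with key B ≤? key B′
  ... | yes le = B ∷ B′ ∷ bs , (le ∷ All.map (≤-trans le) s) ∷ s ∷ ss , ↭-refl , ⊑-refl
  ... | no ≰ with insert B bs r rs cs ss
  ...   | ds , sorted , perm , below =
    B′ ∷ ds , All-resp-↭ (↭-sym perm) (<⇒≤ (≰⇒> ≰) ∷ s) ∷ sorted ,
    ↭-trans (prep B′ perm) (swap B′ B ↭-refl) ,
    ⊑-trans (⊑-∷∷ _ _ below) (⊑-exchange bs r r′ c (≰⇒> ≰))

  sort : ∀ bs → All Rising bs → AllPairs Compatible bs →
    ∃[ cs ] (Sorted cs × cs ↭ bs × flatten cs ⊑ flatten bs)
  sort [] _ _ = [] , [] , ↭-refl , ⊑-refl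
  sort (B ∷ bs) (r ∷ rs) (c ∷ cs) with sort bs rs cs
  ... | ds , sorted , perm , below
    with insert B ds r (All-resp-↭ (↭-sym perm) rs) (All-resp-↭ (↭-sym perm) c) sorted
  ... | es , sorted′ , perm′ , below′ =
    es , sorted′ , ↭-trans perm′ (prep B perm) , ⊑-trans below′ (⊑-∷∷ _ _ below)

-- If the later block has the smaller left endpoint, compatibility makes its right endpoint at least
-- as large. The later arc encloses the earlier one, and putting it first is a step down.
module SortLeft = InsertionSort proj₁ _≼_ ≼-refl ≼-trans ≼-∷∷
  (λ bs a<b _ c lt → inj₁ [ step [] 0 _ _ _ _ (flatten bs) refl
    (<⇒≤ lt) (<⇒≤ a<b) (≮⇒≥ λ gt → c (lt , gt)) ])

-- Dually, a later block with smaller right endpoint is enclosed by the earlier one, and putting it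
-- first is a step up.
module SortRight = InsertionSort proj₂ (λ u v → v ≼ u) ≼-refl (λ p q → ≼-trans q p) ≼-∷∷
  (λ bs _ a<b′ c lt → inj₁ [ step [] 0 _ _ _ _ (flatten bs) refl
    (≮⇒≥ λ gt → c (gt , lt)) (<⇒≤ a<b′) (<⇒≤ lt) ])

-- The extremal linear extensions

module _ {P : Pred ℕ 0ℓ} (P? : Decidable P) where

  concatMap-filter : ∀ (g h : ℕ → ℕ) l →
    concatMap (λ a → if Dec.does (P? a) then g a ∷ h a ∷ [] else []) l ≡
    flatten (map (λ a → g a , h a) (filter P? l))
  concatMap-filter g h [] = refl
  concatMap-filter g h (a ∷ l) with Dec.does (P? a)
  ... | true = cong (λ t → g a ∷ h a ∷ t) (concatMap-filter g h l)
  ... | false = concatMap-filter g h l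

  module _ {Q : Pred ℕ 0ℓ} (Q? : Decidable Q) where

    map-filter : ∀ {f : ℕ → ℕ} {l} → All (λ a → (P a → Q (f a)) × (Q (f a) → P a)) l →
      map f (filter P? l) ≡ filter Q? (map f l)
    map-filter [] = refl
    map-filter {f} {a ∷ l} ((to , from) ∷ hs) with P? a
    ... | yes p = ≡-trans (cong (f a ∷_) (map-filter hs)) (sym (filter-accept Q? (to p)))
    ... | no ¬p = ≡-trans (map-filter hs) (sym (filter-reject Q? (¬p ∘ from)))

    filter-complement-↭ : ∀ {l} → All (λ a → (P a × ¬ Q a) ⊎ (¬ P a × Q a)) l →
      filter P? l ++ filter Q? l ↭ l
    filter-complement-↭ [] = ↭-refl
    filter-complement-↭ {a ∷ l} (inj₁ (p , ¬q) ∷ hs)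
      rewrite filter-accept P? {xs = l} p | filter-reject Q? {xs = l} ¬q =
      prep a (filter-complement-↭ hs)
    filter-complement-↭ {a ∷ l} (inj₂ (¬p , q) ∷ hs)
      rewrite filter-reject P? {xs = l} ¬p | filter-accept Q? {xs = l} q =
      ↭-trans (shift a (filter P? l) (filter Q? l)) (prep a (filter-complement-↭ hs))

flatten-↭ : ∀ bs → flatten bs ↭ map proj₁ bs ++ map proj₂ bs
flatten-↭ [] = ↭-refl
flatten-↭ ((a , b) ∷ bs) =
  prep a (↭-trans (prep b (flatten-↭ bs)) (↭-sym (shift b (map proj₁ bs) (map proj₂ bs))))

module _ (n : ℕ) (x : List ℕ) (fpf : IsFPFInvolution n x) where

  private
    m = 2 * n
    px : IsPerm m x
    px = proj₁ fpf

    involutive : ∀ {j} → InRange m j → at x (at x j) ≡ j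
    involutive (p , q) = proj₁ (proj₂ fpf _ p q)

    opener? : Decidable (λ a → a < at x a)
    opener? a = a <? at x a

    closer? : Decidable (λ d → at x d < d)
    closer? d = at x d <? d

    openers closers : List ℕ
    openers = filter opener? (range m)
    closers = filter closer? (range m)

    map-at-range : map (at x) (range m) ≡ x
    map-at-range = at-ext _ _ (≡-trans lengths (sym (perm-length px))) λ {k} p →
      let p′ = subst (λ l → InRange l k) lengths p in
      ≡-trans (perm-at-map (perm-range m) (at x) p′) (cong (at x) (at-range p′))
      where
      lengths : length (map (at x) (range m)) ≡ m
      lengths = ≡-trans (length-map (at x) (range m)) (length-applyUpTo suc m)

    inRange : All (InRange m) (range m)
    inRange = All.tabulate (perm-∈⁻ (perm-range m))

    -- The one-line word of `x` is itself a rearrangement of `range m`, and its entries that are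
    -- closers are the partners of the openers.
    partners-openers : map (at x) openers ↭ closers
    partners-openers = ↭-trans
      (↭-reflexive (≡-trans (map-filter opener? closer? (All.map
        (λ {a} p → subst (_< at x a) (sym (involutive p)) , subst (_< at x a) (involutive p))
        inRange))
        (cong (filter closer?) map-at-range)))
      (filter-↭ closer? px)

    openers-closers : openers ++ closers ↭ range m
    openers-closers = filter-complement-↭ opener? closer? (All.map split inRange)
      where
      split : ∀ {a} → InRange m a →
        (a < at x a × ¬ (at x a < a)) ⊎ (¬ (a < at x a) × at x a < a)
      split {a} (p , q) with <-cmp a (at x a)
      ... | tri< lt _ ¬gt = inj₁ (lt , ¬gt)
      ... | tri≈ _ eq _ = contradiction (sym eq) (proj₂ (proj₂ fpf a p q))
      ... | tri> ¬lt _ gt = inj₂ (¬lt , gt)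

    zeroBlocks oneBlocks : List Block
    zeroBlocks = map (λ a → a , at x a) openers
    oneBlocks = map (λ d → at x d , d) closers

    zeroHat≡ : zeroHat n x ≡ flatten zeroBlocks
    zeroHat≡ = concatMap-filter opener? id (at x) (range m)

    oneHat≡ : oneHat n x ≡ flatten oneBlocks
    oneHat≡ = concatMap-filter closer? (at x) id (range m)

    increasing : AllPairs _<_ (range m)
    increasing = AllPairsProperties.applyUpTo⁺₁ suc m λ i<j _ → s≤s i<j

  -- Without fixed points every value is an opener or a closer, and the second entries of the blocks
  -- run through the closers.
  perm-zeroHat : IsPerm m (zeroHat n x)
  perm-zeroHat rewrite zeroHat≡ = ↭-trans (flatten-↭ zeroBlocks) (↭-trans
    (++⁺ (↭-reflexive (≡-trans (sym (map-∘ openers)) (map-id openers)))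
         (↭-trans (↭-reflexive (sym (map-∘ openers))) partners-openers))
    openers-closers)

  linearExtension-zeroHat : LinearExtension x (zeroHat n x)
  linearExtension-zeroHat = zeroBlocks , zeroHat≡ ,
    AllProperties.map⁺ (All.zipWith (λ (lt , p) → lt , refl , involutive p)
      (AllProperties.all-filter opener? (range m) , AllProperties.filter⁺ opener? inRange)) ,
    AllPairsProperties.map⁺ (AllPairs.map (λ lt (gt , _) → <-asym lt gt)
      (AllPairsProperties.filter⁺ opener? increasing))

  linearExtension-oneHat : LinearExtension x (oneHat n x)
  linearExtension-oneHat = oneBlocks , oneHat≡ ,
    AllProperties.map⁺ (All.zipWith (λ (lt , p) → lt , involutive p , refl)
      (AllProperties.all-filter closer? (range m) , AllProperties.filter⁺ closer? inRange)) ,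
    AllPairsProperties.map⁺ (AllPairs.map (λ lt (_ , gt) → <-asym lt gt)
      (AllPairsProperties.filter⁺ closer? increasing))

  private
    filter-openers : ∀ {bs} → All (Arc x) bs → filter opener? (flatten bs) ≡ map proj₁ bs
    filter-openers [] = refl
    filter-openers {(a , b) ∷ bs} ((a<b , xa , xb) ∷ arcs) = ≡-trans
      (filter-accept opener? (subst (a <_) (sym xa) a<b))
      (cong (a ∷_) (≡-trans
        (filter-reject opener? (λ lt → <-asym a<b (subst (b <_) xb lt)))
        (filter-openers arcs)))

    filter-closers : ∀ {bs} → All (Arc x) bs → filter closer? (flatten bs) ≡ map proj₂ bs
    filter-closers [] = refl
    filter-closers {(a , b) ∷ bs} ((a<b , xa , xb) ∷ arcs) = ≡-trans
      (filter-reject closer? (λ lt → <-asym a<b (subst (_< a) xa lt)))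
      (≡-trans (filter-accept closer? (subst (_< b) (sym xb) a<b))
        (cong (b ∷_) (filter-closers arcs)))

  module _ {u : List ℕ} (perm : IsPerm m u) where

    -- The outcome of the sort is forced: its left endpoints are the openers in increasing order,
    -- and each one determines its partner.
    linearExtension⇒zeroHat≼ : LinearExtension x u → zeroHat n x ≼ u
    linearExtension⇒zeroHat≼ (bs , refl , arcs , compat)
      with SortLeft.sort bs (All.map proj₁ arcs) compat
    ... | cs , sorted , cs↭bs , below =
      subst (_≼ flatten bs) (sym (≡-trans zeroHat≡ (cong flatten blocks≡))) below
      where
      arcs′ : All (Arc x) cs
      arcs′ = All-resp-↭ (↭-sym cs↭bs) arcs
      lefts : map proj₁ cs ↭ openers
      lefts = ↭-trans (↭-map⁺ proj₁ cs↭bs)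
        (↭-trans (↭-reflexive (sym (filter-openers arcs))) (filter-↭ opener? perm))
      blocks≡ : zeroBlocks ≡ cs
      blocks≡ = ≡-trans
        (cong (map (λ a → a , at x a)) (sorted-↭-unique
          (Linked.AllPairs⇒Linked
            (AllPairs.map <⇒≤ (AllPairsProperties.filter⁺ opener? increasing)))
          (Linked.AllPairs⇒Linked (AllPairsProperties.map⁺ sorted))
          (↭-sym lefts)))
        (≡-trans (sym (map-∘ cs))
          (≡-trans (map-cong-local (All.map (λ (_ , xa , _) → cong (_ ,_) xa) arcs′)) (map-id cs)))

    linearExtension⇒≼oneHat : LinearExtension x u → u ≼ oneHat n x
    linearExtension⇒≼oneHat (bs , refl , arcs , compat)
      with SortRight.sort bs (All.map proj₁ arcs) compat
    ... | cs , sorted , cs↭bs , above =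
      subst (flatten bs ≼_) (sym (≡-trans oneHat≡ (cong flatten blocks≡))) above
      where
      arcs′ : All (Arc x) cs
      arcs′ = All-resp-↭ (↭-sym cs↭bs) arcs
      rights : map proj₂ cs ↭ closers
      rights = ↭-trans (↭-map⁺ proj₂ cs↭bs)
        (↭-trans (↭-reflexive (sym (filter-closers arcs))) (filter-↭ closer? perm))
      blocks≡ : oneBlocks ≡ cs
      blocks≡ = ≡-trans
        (cong (map (λ d → at x d , d)) (sorted-↭-unique
          (Linked.AllPairs⇒Linked
            (AllPairs.map <⇒≤ (AllPairsProperties.filter⁺ closer? increasing)))
          (Linked.AllPairs⇒Linked (AllPairsProperties.map⁺ sorted))
          (↭-sym rights)))
        (≡-trans (sym (map-∘ cs))
          (≡-trans (map-cong-local (All.map (λ (_ , _ , xb) → cong (_, _) xb) arcs′)) (map-id cs)))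

-- Invariance under steps

flatten-++ : ∀ bs cs → flatten (bs ++ cs) ≡ flatten bs ++ flatten cs
flatten-++ [] cs = refl
flatten-++ ((a , b) ∷ bs) cs = cong (λ l → a ∷ b ∷ l) (flatten-++ bs cs)

-- The even prefix length in `Step` places the cut on a block boundary, so a step exchanges two
-- whole blocks.
flatten-split : ∀ k pre {suf} bs → length pre ≡ 2 * k → pre ++ suf ≡ flatten bs →
  ∃[ cs ] ∃[ ds ] (bs ≡ cs ++ ds × pre ≡ flatten cs × suf ≡ flatten ds)
flatten-split k [] bs _ eq = [] , bs , refl , refl , eq
flatten-split k (p ∷ []) bs len≡ _ = contradiction (sym len≡) (even≢odd k 0)
flatten-split (suc k) (p ∷ q ∷ pre) ((a , b) ∷ bs) len≡ eq with ∷-injective eq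
... | refl , eq′ with ∷-injective eq′
... | refl , eq″ with flatten-split k pre bs
      (suc-injective (suc-injective (≡-trans len≡ (*-suc 2 k)))) eq″
... | cs , ds , refl , refl , suf≡ = (a , b) ∷ cs , ds , refl , refl , suf≡

AllPairs-exchange : ∀ {A : Set} {R : A → A → Set} {x y zs} ws → R y x →
  AllPairs R (ws ++ x ∷ y ∷ zs) → AllPairs R (ws ++ y ∷ x ∷ zs)
AllPairs-exchange [] r ((_ ∷ xs) ∷ ys ∷ rs) = (r ∷ ys) ∷ xs ∷ rs
AllPairs-exchange (w ∷ ws) r (p ∷ rs) =
  All-resp-↭ (++⁺ˡ ws (swap _ _ ↭-refl)) p ∷ AllPairs-exchange ws r rs

linearExtension-exchange : ∀ x pre k p q r s suf → length pre ≡ 2 * k →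
  Compatible (r , s) (p , q) →
  LinearExtension x (pre ++ p ∷ q ∷ r ∷ s ∷ suf) → LinearExtension x (pre ++ r ∷ s ∷ p ∷ q ∷ suf)
linearExtension-exchange x pre k p q r s suf len≡ c (bs , eq , arcs , compat)
  with flatten-split k pre bs len≡ eq
... | cs , (_ , _) ∷ (_ , _) ∷ ds , refl , refl , refl =
  cs ++ (r , s) ∷ (p , q) ∷ ds , sym (flatten-++ cs _) ,
  All-resp-↭ (++⁺ˡ cs (swap _ _ ↭-refl)) arcs , AllPairs-exchange cs c compat

module _ (x : List ℕ) where

  -- Nested arcs are incomparable, so either order is admissible: `c ≤ d` justifies the new order
  -- here, `a ≤ b` the old one in the reverse direction.
  linearExtension-step : ∀ {u v} → Step u v → LinearExtension x u → LinearExtension x v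
  linearExtension-step (step pre k a b c d suf len≡ _ _ c≤d) =
    linearExtension-exchange x pre k a d b c suf len≡ λ (_ , d<c) → <⇒≱ d<c c≤d

  linearExtension-step⁻ : ∀ {u v} → Step u v → LinearExtension x v → LinearExtension x u
  linearExtension-step⁻ (step pre k a b c d suf len≡ a≤b _ _) =
    linearExtension-exchange x pre k b c a d suf len≡ λ (b<a , _) → <⇒≱ b<a a≤b

  linearExtension-≼ : ∀ {u v} → u ≼ v → LinearExtension x u → LinearExtension x v
  linearExtension-≼ (inj₁ [ s ]) = linearExtension-step s
  linearExtension-≼ (inj₁ (s ∷ p)) = linearExtension-≼ (inj₁ p) ∘ linearExtension-step s
  linearExtension-≼ (inj₂ refl) = id

  linearExtension-≼⁻ : ∀ {u v} → u ≼ v → LinearExtension x v → LinearExtension x u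
  linearExtension-≼⁻ (inj₁ [ s ]) = linearExtension-step⁻ s
  linearExtension-≼⁻ (inj₁ (s ∷ p)) = linearExtension-step⁻ s ∘ linearExtension-≼⁻ (inj₁ p)
  linearExtension-≼⁻ (inj₂ refl) = id

-- Atoms as linear extensions, and the two descriptions by 0̂ and 1̂

atoms⇔linearExtensions : ∀ n x → IsFPFInvolution n x → ∀ u →
  InAFPFinv n x u ⇔ (IsPerm (2 * n) u × LinearExtension x u)
atoms⇔linearExtensions n x fpf u = mk⇔ to from
  where
  m = 2 * n
  px = proj₁ fpf
  py = perm-wfpf n
  base = linearExtension-wfpf n
  extends : ∀ {v} → IsPerm m v → LinearExtension x v →
    twist (wfpf n) (invPerm v) (redWord (invPerm v)) ≡ x ×
    len x ≡ len (wfpf n) + 2 * len (invPerm v)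
  extends pv ext = linearExtension⇒twist py base (reduced (perm-invPerm pv)) px
    (subst (LinearExtension x) (sym (invPerm-involutive pv)) ext)
  cancel : ∀ {k l} → len (wfpf n) + 2 * k ≤ len (wfpf n) + 2 * l → k ≤ l
  cancel le = *-cancelˡ-≤ 2 (+-cancelˡ-≤ (len (wfpf n)) _ _ le)
  to : InAFPFinv n x u → IsPerm m u × LinearExtension x u
  -- One inequality is the general length bound. For the other, minimality is tested against the
  -- inverse of `zeroHat n x`, which attains the bound.
  to (w , (pw , refl , minimal) , refl) = perm-invPerm pw ,
    twist⇒linearExtension py base (reduced pw) (≤-antisym (len-twist-≤ py (reduced pw))
      (≤-trans (+-monoʳ-≤ (len (wfpf n)) (*-monoʳ-≤ 2
          (minimal _ (perm-invPerm perm₀) (proj₁ witness))))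
        (≤-reflexive (sym (proj₂ witness)))))
    where
    perm₀ = perm-zeroHat n x fpf
    witness = extends perm₀ (linearExtension-zeroHat n x fpf)
  from : IsPerm m u × LinearExtension x u → InAFPFinv n x u
  -- Every competitor obeys the bound that `invPerm u` attains, so cancelling `len (wfpf n)` and the
  -- factor 2 yields minimality.
  from (pu , ext) = invPerm u ,
    (perm-invPerm pu , proj₁ (extends pu ext) , λ { v pv refl → cancel
      (≤-trans (≤-reflexive (sym (proj₂ (extends pu ext)))) (len-twist-≤ py (reduced pv))) }) ,
    sym (invPerm-involutive pu)

theorem6p25 : (n : ℕ) (x : List ℕ) → IsFPFInvolution n x →
    (u : List ℕ) →
    (InAFPFinv n x u ⇔ (IsPerm (2 * n) u × zeroHat n x ≼ u)) ×
    (InAFPFinv n x u ⇔ (IsPerm (2 * n) u × u ≼ oneHat n x))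
theorem6p25 n x fpf u =
  mk⇔ (λ atom → let pu , ext = Equivalence.to atoms atom in
        pu , linearExtension⇒zeroHat≼ n x fpf pu ext)
      -- Being a linear extension is carried upward from 0̂ here, and downward from 1̂ in the second
      -- equivalence.
      (λ (pu , le) → Equivalence.from atoms
        (pu , linearExtension-≼ x le (linearExtension-zeroHat n x fpf))) ,
  mk⇔ (λ atom → let pu , ext = Equivalence.to atoms atom in
        pu , linearExtension⇒≼oneHat n x fpf pu ext)
      (λ (pu , le) → Equivalence.from atoms
        (pu , linearExtension-≼⁻ x le (linearExtension-oneHat n x fpf)))
  where
  atoms = atoms⇔linearExtensions n x fpf u
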